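{- Let $n,d\ge1$ be integers. Let $\Lambda_n^{(d)}$ be the $\mathbb{Q}$-vector space of symmetric polynomials in $x_1,\dots,x_n$ whose degree in each variable does not exceed $d$, with the $\mathfrak{sl}_2$-action $$\mathfrak{e}_+\mapsto\sum_{k=1}^n\Big(-x_k^2\frac{\partial}{\partial x_k}+d\,x_k\Big),\qquad \mathfrak{h}\mapsto 2\sum_{k=1}^n x_k\frac{\partial}{\partial x_k}-nd,\qquad \mathfrak{e}_-\mapsto\sum_{k=1}^n\frac{\partial}{\partial x_k}.$$ Then $\Lambda_n^{(d)}$ is a finite-dimensional $\mathfrak{sl}_2$-submodule of the space $\Lambda_n$ of all symmetric polynomials in $x_1,\dots,x_n$ over $\mathbb{Q}$ (with the action given by the same formulas), and it is isomorphic as an $\mathfrak{sl}_2$-module to the symmetric power $\mathrm{Sym}^n(V_d)$.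
   Context: $\mathfrak{sl}_2$ has basis $\mathfrak{e}_-,\mathfrak{h},\mathfrak{e}_+$ with $[\mathfrak{h},\mathfrak{e}_+]=2\mathfrak{e}_+$, $[\mathfrak{h},\mathfrak{e}_-]=-2\mathfrak{e}_-$, $[\mathfrak{e}_+,\mathfrak{e}_-]=\mathfrak{h}$; an $\mathfrak{sl}_2$-module is a $\mathbb{Q}$-vector space with three endomorphisms (the images of these basis elements) satisfying these relations. $V_d$ denotes the standard irreducible $\mathfrak{sl}_2$-module of dimension $d+1$ with basis $v_0,\dots,v_d$ and action $\mathfrak{e}_+v_i=(d-i)v_{i+1}$, $\mathfrak{h}v_i=(2i-d)v_i$, $\mathfrak{e}_-v_i=i\,v_{i-1}$ (with $v_{ -1}=v_{d+1}=0$). $\mathrm{Sym}^n(V_d)$ is the degree-$n$ component of the symmetric algebra of $V_d$, on which $\mathfrak{sl}_2$ acts by derivations extending the action on $V_d$. -}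

module Defs where

open import Algebra.Bundles using (CommutativeRing; CommutativeSemiring; Ring)
open import Algebra.Module.Bundles using (LeftModule)
open import Algebra.Module.Morphism.Structures using (module LeftModuleMorphisms)
open import Data.Fin.Base as Fin using (Fin; zero; suc; toℕ)
import Data.Fin.Properties as Finₚ
open import Data.Fin.Permutation using (Permutation′; _⟨$⟩ʳ_)
open import Data.Integer.Base as ℤ using (+_)
import Data.Integer.Properties as ℤₚ
open import Data.List.Base as List using (List; [])
open import Data.List.Membership.Propositional using (_∈_; _∉_)
open import Data.List.Membership.Propositional.Properties using (∈-map⁺; ∈-++⁺ˡ; ∈-++⁺ʳ)
open import Data.Nat.Base as ℕ using (ℕ; zero; suc; pred; _≤_; _<_; s≤s)
import Data.Nat.Properties as ℕₚ
open import Data.Product.Base using (Σ; Σ-syntax; ∃-syntax; _×_; _,_; proj₁; proj₂)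
open import Data.Rational.Base using (ℚ; 0ℚ; 1ℚ; _+_; _*_; _-_; -_; _/_; toℚᵘ)
open import Data.Rational.Properties as ℚₚ using (+-*-commutativeRing)
import Data.Rational.Unnormalised.Base as ℚᵘ
import Data.Rational.Unnormalised.Properties as ℚᵘₚ
open import Data.Sum.Base using (inj₁; inj₂)
open import Data.Vec.Base as Vec using (Vec; []; _∷_; lookup; tabulate; updateAt)
open import Data.Vec.Properties using (updateAt-updateAt; updateAt-updateAt-local; updateAt-id; updateAt-id-local)
open import Function.Base using (_∘_)
open import Relation.Binary.PropositionalEquality
  using (_≡_; _≢_; refl; sym; trans; cong; cong₂; subst)
open import Level using (0ℓ)

import Algebra.Properties.CommutativeMonoid.Sum as MonoidSum
import Algebra.Properties.AbelianGroup as AbelianGroupProperties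
import Algebra.Solver.Ring.NaturalCoefficients.Default as SemiringSolver
import Relation.Binary.Reasoning.Setoid as SetoidReasoning
import Data.Rational.Solver as ℚSolver

ℚ-ring : Ring 0ℓ 0ℓ
ℚ-ring = CommutativeRing.ring +-*-commutativeRing

VectorSpace : Set₁
VectorSpace = LeftModule ℚ-ring 0ℓ 0ℓ

fromℕ : ℕ → ℚ
fromℕ k = + k / 1

module _ (U V : VectorSpace) where
  private
    module U = LeftModule U
    module V = LeftModule V

  IsLinear : (U.Carrierᴹ → V.Carrierᴹ) → Set
  IsLinear = LeftModuleMorphisms.IsLeftModuleHomomorphism U.rawLeftModule V.rawLeftModule

  IsLinearIsomorphism : (U.Carrierᴹ → V.Carrierᴹ) → Set
  IsLinearIsomorphism = LeftModuleMorphisms.IsLeftModuleIsomorphism U.rawLeftModule V.rawLeftModule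

module _ (V : VectorSpace) where
  open LeftModule V
  open MonoidSum +ᴹ-commutativeMonoid using (sum)

  linearCombination : ∀ {k} → (Fin k → ℚ) → (Fin k → Carrierᴹ) → Carrierᴹ
  linearCombination c b = sum (λ i → c i *ₗ b i)

  record IsBasis {k} (b : Fin k → Carrierᴹ) : Set where
    field
      independent : ∀ c → linearCombination c b ≈ᴹ 0ᴹ → ∀ i → c i ≡ 0ℚ
      spanning    : ∀ v → ∃[ c ] v ≈ᴹ linearCombination c b

  FiniteDimensional : Set
  FiniteDimensional = Σ[ k ∈ ℕ ] Σ[ b ∈ (Fin k → Carrierᴹ) ] IsBasis b

  record IsSubspace (P : Carrierᴹ → Set) : Set where
    field
      resp      : ∀ {u v} → u ≈ᴹ v → P u → P v
      0ᴹ-closed : P 0ᴹ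
      +ᴹ-closed : ∀ {u v} → P u → P v → P (u +ᴹ v)
      *ₗ-closed : ∀ c {v} → P v → P (c *ₗ v)

data Basis-sl₂ : Set where
  𝔢₋ 𝔥 𝔢₊ : Basis-sl₂

record IsSl₂Action (V : VectorSpace)
                   (ρ : Basis-sl₂ → LeftModule.Carrierᴹ V → LeftModule.Carrierᴹ V) : Set where
  open LeftModule V

  commutator : Basis-sl₂ → Basis-sl₂ → Carrierᴹ → Carrierᴹ
  commutator x y v = ρ x (ρ y v) +ᴹ -ᴹ ρ y (ρ x v)

  field
    linear  : ∀ x → IsLinear V V (ρ x)
    [𝔥,𝔢₊]  : ∀ v → commutator 𝔥 𝔢₊ v ≈ᴹ fromℕ 2 *ₗ ρ 𝔢₊ v
    [𝔥,𝔢₋]  : ∀ v → commutator 𝔥 𝔢₋ v ≈ᴹ (- fromℕ 2) *ₗ ρ 𝔢₋ v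
    [𝔢₊,𝔢₋] : ∀ v → commutator 𝔢₊ 𝔢₋ v ≈ᴹ ρ 𝔥 v

record Sl₂Module : Set₁ where
  field
    space       : VectorSpace
    ρ           : Basis-sl₂ → LeftModule.Carrierᴹ space → LeftModule.Carrierᴹ space
    isSl₂Action : IsSl₂Action space ρ
  open LeftModule space public
  open IsSl₂Action isSl₂Action public

record _≅_ (M N : Sl₂Module) : Set where
  private
    module M = Sl₂Module M
    module N = Sl₂Module N
  field
    to          : M.Carrierᴹ → N.Carrierᴹ
    isomorphism : IsLinearIsomorphism M.space N.space to
    equivariant : ∀ x v → to (M.ρ x v) N.≈ᴹ N.ρ x (to v)

record IsSl₂Submodule (M : Sl₂Module) (P : Sl₂Module.Carrierᴹ M → Set) : Set where
  open Sl₂Module M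
  field
    isSubspace : IsSubspace space P
    ρ-closed   : ∀ x {v} → P v → P (ρ x v)
  open IsSubspace isSubspace public

module _ (V : VectorSpace) where
  open LeftModule V
  open SetoidReasoning ≈ᴹ-setoid
  open AbelianGroupProperties +ᴹ-abelianGroup using (inverseʳ-unique)

  -ᴹ≈-1 : ∀ v → -ᴹ v ≈ᴹ (- 1ℚ) *ₗ v
  -ᴹ≈-1 v = ≈ᴹ-sym (inverseʳ-unique v _ (begin
    v +ᴹ (- 1ℚ) *ₗ v          ≈⟨ +ᴹ-congʳ (≈ᴹ-sym (*ₗ-identityˡ v)) ⟩
    1ℚ *ₗ v +ᴹ (- 1ℚ) *ₗ v    ≈⟨ ≈ᴹ-sym (*ₗ-distribʳ v 1ℚ (- 1ℚ)) ⟩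
    0ℚ *ₗ v                   ≈⟨ *ₗ-zeroˡ v ⟩
    0ᴹ                        ∎))

  commutes⇒difference : ∀ {a b c} → a ≈ᴹ b +ᴹ c → a +ᴹ -ᴹ b ≈ᴹ c
  commutes⇒difference {a} {b} {c} eq = begin
    a +ᴹ -ᴹ b           ≈⟨ +ᴹ-congʳ (≈ᴹ-trans eq (+ᴹ-comm b c)) ⟩
    (c +ᴹ b) +ᴹ -ᴹ b    ≈⟨ +ᴹ-assoc c b (-ᴹ b) ⟩
    c +ᴹ (b +ᴹ -ᴹ b)    ≈⟨ +ᴹ-congˡ (-ᴹ‿inverseʳ b) ⟩
    c +ᴹ 0ᴹ             ≈⟨ +ᴹ-identityʳ c ⟩
    c                   ∎

  difference⇒commutes : ∀ {a b c} → a +ᴹ -ᴹ b ≈ᴹ c → a ≈ᴹ b +ᴹ c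
  difference⇒commutes {a} {b} {c} eq = begin
    a                   ≈⟨ ≈ᴹ-sym (+ᴹ-identityˡ a) ⟩
    0ᴹ +ᴹ a             ≈⟨ +ᴹ-congʳ (≈ᴹ-sym (-ᴹ‿inverseʳ b)) ⟩
    (b +ᴹ -ᴹ b) +ᴹ a    ≈⟨ +ᴹ-assoc b (-ᴹ b) a ⟩
    b +ᴹ (-ᴹ b +ᴹ a)    ≈⟨ +ᴹ-congˡ (≈ᴹ-trans (+ᴹ-comm _ _) eq) ⟩
    b +ᴹ c              ∎

module _ (U V : VectorSpace) where
  private
    module U = LeftModule U
    module V = LeftModule V
  open SetoidReasoning V.≈ᴹ-setoid

  mkLinear : (f : U.Carrierᴹ → V.Carrierᴹ) →
             (∀ {u v} → u U.≈ᴹ v → f u V.≈ᴹ f v) →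
             (∀ u v → f (u U.+ᴹ v) V.≈ᴹ f u V.+ᴹ f v) →
             (∀ c v → f (c U.*ₗ v) V.≈ᴹ c V.*ₗ f v) →
             IsLinear U V f
  mkLinear f f-cong f-+ f-*ₗ = record
    { +ᴹ-isGroupHomomorphism = record
      { isMonoidHomomorphism = record
        { isMagmaHomomorphism = record
          { isRelHomomorphism = record { cong = f-cong }
          ; homo = f-+
          }
        ; ε-homo = begin
            f U.0ᴹ              ≈⟨ f-cong (U.≈ᴹ-sym (U.*ₗ-zeroˡ U.0ᴹ)) ⟩
            f (0ℚ U.*ₗ U.0ᴹ)    ≈⟨ f-*ₗ 0ℚ U.0ᴹ ⟩
            0ℚ V.*ₗ f U.0ᴹ      ≈⟨ V.*ₗ-zeroˡ _ ⟩
            V.0ᴹ                ∎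
        }
      ; ⁻¹-homo = λ v → begin
          f (U.-ᴹ v)            ≈⟨ f-cong (-ᴹ≈-1 U v) ⟩
          f ((- 1ℚ) U.*ₗ v)     ≈⟨ f-*ₗ (- 1ℚ) v ⟩
          (- 1ℚ) V.*ₗ f v       ≈⟨ V.≈ᴹ-sym (-ᴹ≈-1 V (f v)) ⟩
          V.-ᴹ f v              ∎
      }
    ; *ₗ-homo = f-*ₗ
    }

  linear-cong : ∀ {f} → IsLinear U V f → ∀ {u v} → u U.≈ᴹ v → f u V.≈ᴹ f v
  linear-cong = LeftModuleMorphisms.IsLeftModuleHomomorphism.⟦⟧-cong

  linear-+ : ∀ {f} → IsLinear U V f → ∀ u v → f (u U.+ᴹ v) V.≈ᴹ f u V.+ᴹ f v
  linear-+ = LeftModuleMorphisms.IsLeftModuleHomomorphism.+ᴹ-homo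

  linear-*ₗ : ∀ {f} → IsLinear U V f → ∀ c v → f (c U.*ₗ v) V.≈ᴹ c V.*ₗ f v
  linear-*ₗ = LeftModuleMorphisms.IsLeftModuleHomomorphism.*ₗ-homo

module _ (V : VectorSpace) {P : LeftModule.Carrierᴹ V → Set} (S : IsSubspace V P) where
  open LeftModule V
  open IsSubspace S

  subspace : VectorSpace
  subspace = record
    { Carrierᴹ = Σ Carrierᴹ P
    ; _≈ᴹ_ = λ u v → proj₁ u ≈ᴹ proj₁ v
    ; _+ᴹ_ = λ u v → proj₁ u +ᴹ proj₁ v , +ᴹ-closed (proj₂ u) (proj₂ v)
    ; _*ₗ_ = λ c v → c *ₗ proj₁ v , *ₗ-closed c (proj₂ v)
    ; 0ᴹ = 0ᴹ , 0ᴹ-closed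
    ; -ᴹ_ = λ v → -ᴹ proj₁ v , resp (≈ᴹ-sym (-ᴹ≈-1 V (proj₁ v))) (*ₗ-closed (- 1ℚ) (proj₂ v))
    ; isLeftModule = record
      { isLeftSemimodule = record
        { +ᴹ-isCommutativeMonoid = record
          { isMonoid = record
            { isSemigroup = record
              { isMagma = record
                { isEquivalence = record { refl = ≈ᴹ-refl ; sym = ≈ᴹ-sym ; trans = ≈ᴹ-trans }
                ; ∙-cong = +ᴹ-cong
                }
              ; assoc = λ u v w → +ᴹ-assoc _ _ _
              }
            ; identity = (λ v → +ᴹ-identityˡ _) , (λ v → +ᴹ-identityʳ _)
            }
          ; comm = λ u v → +ᴹ-comm _ _
          }
        ; isPreleftSemimodule = record
          { *ₗ-cong = *ₗ-cong
          ; *ₗ-zeroˡ = λ v → *ₗ-zeroˡ _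
          ; *ₗ-distribʳ = λ v c d → *ₗ-distribʳ _ c d
          ; *ₗ-identityˡ = λ v → *ₗ-identityˡ _
          ; *ₗ-assoc = λ c d v → *ₗ-assoc c d _
          ; *ₗ-zeroʳ = *ₗ-zeroʳ
          ; *ₗ-distribˡ = λ c u v → *ₗ-distribˡ c _ _
          }
        }
      ; -ᴹ‿cong = -ᴹ‿cong
      ; -ᴹ‿inverse = (λ v → -ᴹ‿inverseˡ _) , (λ v → -ᴹ‿inverseʳ _)
      }
    }

submodule : (M : Sl₂Module) {P : Sl₂Module.Carrierᴹ M → Set} → IsSl₂Submodule M P → Sl₂Module
submodule M S = record
  { space = subspace space S.isSubspace
  ; ρ = λ x v → ρ x (proj₁ v) , S.ρ-closed x (proj₂ v)
  ; isSl₂Action = record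
    { linear = λ x → mkLinear (subspace space S.isSubspace) (subspace space S.isSubspace) _
        (linear-cong space space (linear x))
        (λ u v → linear-+ space space (linear x) _ _)
        (λ c v → linear-*ₗ space space (linear x) c _)
    ; [𝔥,𝔢₊] = λ v → [𝔥,𝔢₊] (proj₁ v)
    ; [𝔥,𝔢₋] = λ v → [𝔥,𝔢₋] (proj₁ v)
    ; [𝔢₊,𝔢₋] = λ v → [𝔢₊,𝔢₋] (proj₁ v)
    }
  }
  where
  open Sl₂Module M
  module S = IsSl₂Submodule S

-- A polynomial in x₀, …, xₙ₋₁ is its finitely supported family of coefficients; the
-- exponent vector m stands for the monomial ∏ xₖ ^ lookup m k.  Only the
-- coefficients count for equality, not the chosen bound on the support.
record Polynomial (n : ℕ) : Set where
  field
    coeff          : Vec ℕ n → ℚ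
    support        : List (Vec ℕ n)
    finite-support : ∀ m → m ∉ support → coeff m ≡ 0ℚ

open Polynomial public

ℚ[x] : ℕ → VectorSpace
ℚ[x] n = record
  { Carrierᴹ = Polynomial n
  ; _≈ᴹ_ = λ p q → ∀ m → coeff p m ≡ coeff q m
  ; _+ᴹ_ = λ p q → record
    { coeff = λ m → coeff p m + coeff q m
    ; support = support p List.++ support q
    ; finite-support = λ m m∉ → trans
        (cong₂ _+_ (finite-support p m (m∉ ∘ ∈-++⁺ˡ))
                   (finite-support q m (m∉ ∘ ∈-++⁺ʳ (support p))))
        (ℚₚ.+-identityˡ 0ℚ)
    }
  ; _*ₗ_ = λ c p → record
    { coeff = λ m → c * coeff p m
    ; support = support p
    ; finite-support = λ m m∉ → trans (cong (c *_) (finite-support p m m∉)) (ℚₚ.*-zeroʳ c)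
    }
  ; 0ᴹ = record { coeff = λ _ → 0ℚ ; support = [] ; finite-support = λ _ _ → refl }
  ; -ᴹ_ = λ p → record
    { coeff = λ m → - coeff p m
    ; support = support p
    ; finite-support = λ m m∉ → cong -_ (finite-support p m m∉)
    }
  ; isLeftModule = record
    { isLeftSemimodule = record
      { +ᴹ-isCommutativeMonoid = record
        { isMonoid = record
          { isSemigroup = record
            { isMagma = record
              { isEquivalence = record
                { refl = λ m → refl
                ; sym = λ p≈q m → sym (p≈q m)
                ; trans = λ p≈q q≈r m → trans (p≈q m) (q≈r m)
                }
              ; ∙-cong = λ p≈p′ q≈q′ m → cong₂ _+_ (p≈p′ m) (q≈q′ m)
              }
            ; assoc = λ p q r m → ℚₚ.+-assoc (coeff p m) _ _
            }
          ; identity = (λ p m → ℚₚ.+-identityˡ _) , (λ p m → ℚₚ.+-identityʳ _)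
          }
        ; comm = λ p q m → ℚₚ.+-comm (coeff p m) _
        }
      ; isPreleftSemimodule = record
        { *ₗ-cong = λ c≡c′ p≈p′ m → cong₂ _*_ c≡c′ (p≈p′ m)
        ; *ₗ-zeroˡ = λ p m → ℚₚ.*-zeroˡ (coeff p m)
        ; *ₗ-distribʳ = λ p c c′ m → ℚₚ.*-distribʳ-+ (coeff p m) c c′
        ; *ₗ-identityˡ = λ p m → ℚₚ.*-identityˡ (coeff p m)
        ; *ₗ-assoc = λ c c′ p m → ℚₚ.*-assoc c c′ (coeff p m)
        ; *ₗ-zeroʳ = λ c m → ℚₚ.*-zeroʳ c
        ; *ₗ-distribˡ = λ c p q m → ℚₚ.*-distribˡ-+ c (coeff p m) (coeff q m)
        }
      }
    ; -ᴹ‿cong = λ p≈q m → cong -_ (p≈q m)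
    ; -ᴹ‿inverse = (λ p m → ℚₚ.+-inverseˡ (coeff p m)) , (λ p m → ℚₚ.+-inverseʳ (coeff p m))
    }
  }

ifDivisible : ℕ → ℚ → ℚ
ifDivisible zero    c = 0ℚ
ifDivisible (suc _) c = c

module _ {n : ℕ} (k : Fin n) where

  raise lower : Vec ℕ n → Vec ℕ n
  raise m = updateAt m k suc
  lower m = updateAt m k pred

  private
    lower-raise : ∀ m → lower (raise m) ≡ m
    lower-raise m = trans (updateAt-updateAt k m) (updateAt-id k m)

    raise-lower : ∀ m {e} → lookup m k ≡ suc e → raise (lower m) ≡ m
    raise-lower m eq = trans (updateAt-updateAt k m)
      (updateAt-id-local k m (subst (λ e → suc (pred e) ≡ e) (sym eq) refl))

  -- Formal partial derivative ∂p/∂xₖ: the coefficient of m comes from the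
  -- monomial m · xₖ, whose exponent of xₖ is suc (lookup m k).
  ∂ : Polynomial n → Polynomial n
  ∂ p = record
    { coeff = λ m → fromℕ (suc (lookup m k)) * coeff p (raise m)
    ; support = List.map lower (support p)
    ; finite-support = λ m m∉ → trans
        (cong (fromℕ (suc (lookup m k)) *_)
          (finite-support p (raise m)
            (λ m′∈ → m∉ (subst (_∈ List.map lower (support p)) (lower-raise m) (∈-map⁺ lower m′∈)))))
        (ℚₚ.*-zeroʳ (fromℕ (suc (lookup m k))))
    }

  -- Multiplication by xₖ: the coefficient of m is that of m / xₖ in p, and
  -- 0 if xₖ does not divide m.
  x· : Polynomial n → Polynomial n
  x· p = record
    { coeff = λ m → ifDivisible (lookup m k) (coeff p (lower m))
    ; support = List.map raise (support p)
    ; finite-support = λ m m∉ → vanishes m m∉ (lookup m k) refl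
    }
    where
    vanishes : ∀ m → m ∉ List.map raise (support p) → ∀ e → lookup m k ≡ e →
               ifDivisible e (coeff p (lower m)) ≡ 0ℚ
    vanishes m m∉ zero    eq = refl
    vanishes m m∉ (suc e) eq = finite-support p (lower m)
      (λ m′∈ → m∉ (subst (_∈ List.map raise (support p)) (raise-lower m eq) (∈-map⁺ raise m′∈)))

module _ (n d : ℕ) where
  open LeftModule (ℚ[x] n)
  open MonoidSum +ᴹ-commutativeMonoid using (sum)

  diffOp : Basis-sl₂ → Polynomial n → Polynomial n
  diffOp 𝔢₊ p = sum (λ k → -ᴹ x· k (x· k (∂ k p)) +ᴹ fromℕ d *ₗ x· k p)
  diffOp 𝔥  p = fromℕ 2 *ₗ sum (λ k → x· k (∂ k p)) +ᴹ -ᴹ (fromℕ (n ℕ.* d) *ₗ p)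
  diffOp 𝔢₋ p = sum (λ k → ∂ k p)

-- Substituting x_{σ k} for x_k turns x^(m ∘ σ) into x^m, so the coefficient
-- of x^m in the permuted polynomial is the coefficient of x^(m ∘ σ) in p.
Symmetric : ∀ {n} → Polynomial n → Set
Symmetric {n} p = ∀ (σ : Permutation′ n) m →
  coeff p (tabulate (λ k → lookup m (σ ⟨$⟩ʳ k))) ≡ coeff p m

DegreeInEachVariable≤ : ∀ {n} → ℕ → Polynomial n → Set
DegreeInEachVariable≤ d p = ∀ m → coeff p m ≢ 0ℚ → ∀ k → lookup m k ≤ d

polynomials : ∀ {n d} → IsSl₂Action (ℚ[x] n) (diffOp n d) → Sl₂Module
polynomials {n} {d} action = record { space = ℚ[x] n ; ρ = diffOp n d ; isSl₂Action = action }

-- The free commutative ℚ-algebra on V: terms modulo the least congruence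
-- making it a commutative ℚ-algebra with ι linear; con is the structure
-- map from ℚ.
module SymmetricAlgebra (V : VectorSpace) where
  private module V = LeftModule V

  infixl 6 _⊕_
  infixl 7 _⊗_
  infix 4 _∼_

  data Sym : Set where
    con : ℚ → Sym
    ι   : V.Carrierᴹ → Sym
    _⊕_ : Sym → Sym → Sym
    _⊗_ : Sym → Sym → Sym

  data _∼_ : Sym → Sym → Set where
    ∼-refl  : ∀ {x} → x ∼ x
    ∼-sym   : ∀ {x y} → x ∼ y → y ∼ x
    ∼-trans : ∀ {x y z} → x ∼ y → y ∼ z → x ∼ z

    ⊕-cong : ∀ {x x′ y y′} → x ∼ x′ → y ∼ y′ → x ⊕ y ∼ x′ ⊕ y′
    ⊗-cong : ∀ {x x′ y y′} → x ∼ x′ → y ∼ y′ → x ⊗ y ∼ x′ ⊗ y′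
    ι-cong : ∀ {u v} → u V.≈ᴹ v → ι u ∼ ι v

    ⊕-assoc     : ∀ x y z → (x ⊕ y) ⊕ z ∼ x ⊕ (y ⊕ z)
    ⊕-comm      : ∀ x y → x ⊕ y ∼ y ⊕ x
    ⊕-identityˡ : ∀ x → con 0ℚ ⊕ x ∼ x

    ⊗-assoc     : ∀ x y z → (x ⊗ y) ⊗ z ∼ x ⊗ (y ⊗ z)
    ⊗-comm      : ∀ x y → x ⊗ y ∼ y ⊗ x
    ⊗-identityˡ : ∀ x → con 1ℚ ⊗ x ∼ x
    ⊗-zeroˡ     : ∀ x → con 0ℚ ⊗ x ∼ con 0ℚ
    ⊗-distribʳ  : ∀ x y z → (y ⊕ z) ⊗ x ∼ y ⊗ x ⊕ z ⊗ x

    con-+ : ∀ a b → con (a + b) ∼ con a ⊕ con b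
    con-* : ∀ a b → con (a * b) ∼ con a ⊗ con b

    ι-+  : ∀ u v → ι (u V.+ᴹ v) ∼ ι u ⊕ ι v
    ι-*ₗ : ∀ c v → ι (c V.*ₗ v) ∼ con c ⊗ ι v

  ∏ι : ∀ {n} → Vec V.Carrierᴹ n → Sym
  ∏ι []       = con 1ℚ
  ∏ι (v ∷ vs) = ι v ⊗ ∏ι vs

  -- The degree-n component is the linear span of the n-fold products of
  -- elements of V.
  data HasDegree (n : ℕ) : Sym → Set where
    product : (vs : Vec V.Carrierᴹ n) → HasDegree n (∏ι vs)
    zero    : HasDegree n (con 0ℚ)
    add     : ∀ {x y} → HasDegree n x → HasDegree n y → HasDegree n (x ⊕ y)
    scale   : ∀ c {x} → HasDegree n x → HasDegree n (con c ⊗ x)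
    resp    : ∀ {x y} → x ∼ y → HasDegree n x → HasDegree n y

  derivation : (V.Carrierᴹ → V.Carrierᴹ) → Sym → Sym
  derivation f (con c) = con 0ℚ
  derivation f (ι v)   = ι (f v)
  derivation f (x ⊕ y) = derivation f x ⊕ derivation f y
  derivation f (x ⊗ y) = derivation f x ⊗ y ⊕ x ⊗ derivation f y

  commutativeSemiring : CommutativeSemiring 0ℓ 0ℓ
  commutativeSemiring = record
    { Carrier = Sym ; _≈_ = _∼_ ; _+_ = _⊕_ ; _*_ = _⊗_ ; 0# = con 0ℚ ; 1# = con 1ℚ
    ; isCommutativeSemiring = record
      { isSemiring = record
        { isSemiringWithoutAnnihilatingZero = record
          { +-isCommutativeMonoid = record
            { isMonoid = record
              { isSemigroup = record
                { isMagma = record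
                  { isEquivalence = record { refl = ∼-refl ; sym = ∼-sym ; trans = ∼-trans }
                  ; ∙-cong = ⊕-cong
                  }
                ; assoc = ⊕-assoc
                }
              ; identity = ⊕-identityˡ , λ x → ∼-trans (⊕-comm _ _) (⊕-identityˡ x)
              }
            ; comm = ⊕-comm
            }
          ; *-cong = ⊗-cong
          ; *-assoc = ⊗-assoc
          ; *-identity = ⊗-identityˡ , λ x → ∼-trans (⊗-comm _ _) (⊗-identityˡ x)
          ; distrib = (λ x y z → ∼-trans (⊗-comm _ _) (∼-trans (⊗-distribʳ x y z)
                        (⊕-cong (⊗-comm _ _) (⊗-comm _ _))))
                    , ⊗-distribʳ
          }
        ; zero = ⊗-zeroˡ , λ x → ∼-trans (⊗-comm _ _) (⊗-zeroˡ x)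
        }
      ; *-comm = ⊗-comm
      }
    }

  open CommutativeSemiring commutativeSemiring public
    using ()
    renaming ( setoid to ∼-setoid; +-congˡ to ⊕-congˡ; +-congʳ to ⊕-congʳ
             ; *-congˡ to ⊗-congˡ; *-congʳ to ⊗-congʳ; distribˡ to ⊗-distribˡ
             ; zeroʳ to ⊗-zeroʳ; +-identityʳ to ⊕-identityʳ
             ; +-isCommutativeMonoid to ⊕-isCommutativeMonoid)

  private
    ⊕-inverseʳ : ∀ x → x ⊕ con (- 1ℚ) ⊗ x ∼ con 0ℚ
    ⊕-inverseʳ x =
      ∼-trans (⊕-congʳ (∼-sym (⊗-identityˡ x)))
      (∼-trans (∼-sym (⊗-distribʳ x (con 1ℚ) (con (- 1ℚ))))
      (∼-trans (⊗-congʳ (∼-sym (con-+ 1ℚ (- 1ℚ)))) (⊗-zeroˡ x)))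

  space : VectorSpace
  space = record
    { Carrierᴹ = Sym
    ; _≈ᴹ_ = _∼_
    ; _+ᴹ_ = _⊕_
    ; _*ₗ_ = λ c x → con c ⊗ x
    ; 0ᴹ = con 0ℚ
    ; -ᴹ_ = λ x → con (- 1ℚ) ⊗ x
    ; isLeftModule = record
      { isLeftSemimodule = record
        { +ᴹ-isCommutativeMonoid = ⊕-isCommutativeMonoid
        ; isPreleftSemimodule = record
          { *ₗ-cong = λ { refl x∼y → ⊗-congˡ x∼y }
          ; *ₗ-zeroˡ = ⊗-zeroˡ
          ; *ₗ-distribʳ = λ x a b → ∼-trans (⊗-congʳ (con-+ a b)) (⊗-distribʳ x (con a) (con b))
          ; *ₗ-identityˡ = ⊗-identityˡ
          ; *ₗ-assoc = λ a b x → ∼-trans (⊗-congʳ (con-* a b)) (⊗-assoc (con a) (con b) x)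
          ; *ₗ-zeroʳ = λ a → ⊗-zeroʳ (con a)
          ; *ₗ-distribˡ = λ a → ⊗-distribˡ (con a)
          }
        }
      ; -ᴹ‿cong = ⊗-congˡ
      ; -ᴹ‿inverse = (λ x → ∼-trans (⊕-comm _ _) (⊕-inverseʳ x)) , ⊕-inverseʳ
      }
    }

  private module Solver = SemiringSolver commutativeSemiring
  open Solver using (solve; _:+_; _:*_; _:=_)
  open SetoidReasoning ∼-setoid

  module _ {f : V.Carrierᴹ → V.Carrierᴹ} (f-linear : IsLinear V V f) where
    private
      D = derivation f

      D-con : ∀ c x → D (con c ⊗ x) ∼ con c ⊗ D x
      D-con c x = ∼-trans (⊕-congʳ (⊗-zeroˡ x)) (⊕-identityˡ _)

    derivation-cong : ∀ {x y} → x ∼ y → D x ∼ D y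
    derivation-cong ∼-refl = ∼-refl
    derivation-cong (∼-sym e) = ∼-sym (derivation-cong e)
    derivation-cong (∼-trans e e′) = ∼-trans (derivation-cong e) (derivation-cong e′)
    derivation-cong (⊕-cong e e′) = ⊕-cong (derivation-cong e) (derivation-cong e′)
    derivation-cong (⊗-cong e e′) =
      ⊕-cong (⊗-cong (derivation-cong e) e′) (⊗-cong e (derivation-cong e′))
    derivation-cong (ι-cong e) = ι-cong (linear-cong V V f-linear e)
    derivation-cong (⊕-assoc x y z) = ⊕-assoc _ _ _
    derivation-cong (⊕-comm x y) = ⊕-comm _ _
    derivation-cong (⊕-identityˡ x) = ⊕-identityˡ _
    derivation-cong (⊗-assoc x y z) = solve 6
      (λ x y z dx dy dz → (dx :* y :+ x :* dy) :* z :+ (x :* y) :* dz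
                       := dx :* (y :* z) :+ x :* (dy :* z :+ y :* dz))
      ∼-refl x y z (D x) (D y) (D z)
    derivation-cong (⊗-comm x y) = solve 4
      (λ x y dx dy → dx :* y :+ x :* dy := dy :* x :+ y :* dx) ∼-refl x y (D x) (D y)
    derivation-cong (⊗-identityˡ x) = ∼-trans (D-con 1ℚ x) (⊗-identityˡ _)
    derivation-cong (⊗-zeroˡ x) = ∼-trans (D-con 0ℚ x) (⊗-zeroˡ _)
    derivation-cong (⊗-distribʳ x y z) = solve 6
      (λ x y z dx dy dz → (dy :+ dz) :* x :+ (y :+ z) :* dx
                       := (dy :* x :+ y :* dx) :+ (dz :* x :+ z :* dx))
      ∼-refl x y z (D x) (D y) (D z)
    derivation-cong (con-+ a b) = ∼-sym (⊕-identityˡ _)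
    derivation-cong (con-* a b) = ∼-sym (∼-trans (⊕-cong (⊗-zeroˡ _) (⊗-zeroʳ _)) (⊕-identityˡ _))
    derivation-cong (ι-+ u v) = ∼-trans (ι-cong (linear-+ V V f-linear u v)) (ι-+ _ _)
    derivation-cong (ι-*ₗ c v) =
      ∼-trans (ι-cong (linear-*ₗ V V f-linear c v)) (∼-trans (ι-*ₗ c _) (∼-sym (D-con c (ι v))))

    derivation-linear : IsLinear space space D
    derivation-linear = mkLinear space space D derivation-cong (λ _ _ → ∼-refl) D-con

    private
      ι-HasDegree : ∀ {n} v {x} → HasDegree n x → HasDegree (suc n) (ι v ⊗ x)
      ι-HasDegree v (product vs) = product (v ∷ vs)
      ι-HasDegree v zero = resp (∼-sym (⊗-zeroʳ _)) zero
      ι-HasDegree v (add p q) = resp (∼-sym (⊗-distribˡ _ _ _)) (add (ι-HasDegree v p) (ι-HasDegree v q))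
      ι-HasDegree v (scale c {x} p) = resp
        (solve 3 (λ c v x → c :* (v :* x) := v :* (c :* x)) ∼-refl (con c) (ι v) x)
        (scale c (ι-HasDegree v p))
      ι-HasDegree v (resp e p) = resp (⊗-congˡ e) (ι-HasDegree v p)

    derivation-HasDegree : ∀ {n x} → HasDegree n x → HasDegree n (D x)
    derivation-HasDegree (product []) = zero
    derivation-HasDegree (product (v ∷ vs)) =
      add (product (f v ∷ vs)) (ι-HasDegree v (derivation-HasDegree (product vs)))
    derivation-HasDegree zero = zero
    derivation-HasDegree (add p q) = add (derivation-HasDegree p) (derivation-HasDegree q)
    derivation-HasDegree (scale c p) = resp (∼-sym (D-con c _)) (scale c (derivation-HasDegree p))
    derivation-HasDegree (resp e p) = resp (derivation-cong e) (derivation-HasDegree p)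

  HasDegree-isSubspace : ∀ n → IsSubspace space (HasDegree n)
  HasDegree-isSubspace n = record
    { resp = resp ; 0ᴹ-closed = zero ; +ᴹ-closed = add ; *ₗ-closed = scale }

  private
    derivation-commutes : ∀ {f g k} →
      (∀ v → f (g v) V.≈ᴹ g (f v) V.+ᴹ k v) →
      ∀ x → derivation f (derivation g x) ∼ derivation g (derivation f x) ⊕ derivation k x
    derivation-commutes eq (con c) = ∼-sym (⊕-identityˡ _)
    derivation-commutes eq (ι v) = ∼-trans (ι-cong (eq v)) (ι-+ _ _)
    derivation-commutes eq (x ⊕ y) = ∼-trans
      (⊕-cong (derivation-commutes eq x) (derivation-commutes eq y))
      (solve 4 (λ a b c d → (a :+ b) :+ (c :+ d) := (a :+ c) :+ (b :+ d)) ∼-refl _ _ _ _)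
    derivation-commutes {f} {g} {k} eq (x ⊗ y) = begin
      (F (G x) ⊗ y ⊕ G x ⊗ F y) ⊕ (F x ⊗ G y ⊕ x ⊗ F (G y))
        ≈⟨ ⊕-cong (⊕-congʳ (⊗-congʳ (derivation-commutes eq x)))
                  (⊕-congˡ (⊗-congˡ (derivation-commutes eq y))) ⟩
      ((G (F x) ⊕ K x) ⊗ y ⊕ G x ⊗ F y) ⊕ (F x ⊗ G y ⊕ x ⊗ (G (F y) ⊕ K y))
        ≈⟨ solve 10 (λ x y fx fy gx gy kx ky gfx gfy →
             ((gfx :+ kx) :* y :+ gx :* fy) :+ (fx :* gy :+ x :* (gfy :+ ky))
             := ((gfx :* y :+ fx :* gy) :+ (gx :* fy :+ x :* gfy)) :+ (kx :* y :+ x :* ky))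
             ∼-refl x y (F x) (F y) (G x) (G y) (K x) (K y) (G (F x)) (G (F y)) ⟩
      ((G (F x) ⊗ y ⊕ F x ⊗ G y) ⊕ (G x ⊗ F y ⊕ x ⊗ G (F y))) ⊕ (K x ⊗ y ⊕ x ⊗ K y) ∎
      where
      F = derivation f
      G = derivation g
      K = derivation k

    derivation-*ₗ : ∀ c f x → derivation (λ v → c V.*ₗ f v) x ∼ con c ⊗ derivation f x
    derivation-*ₗ c f (con a) = ∼-sym (⊗-zeroʳ _)
    derivation-*ₗ c f (ι v) = ι-*ₗ c (f v)
    derivation-*ₗ c f (x ⊕ y) = ∼-trans
      (⊕-cong (derivation-*ₗ c f x) (derivation-*ₗ c f y)) (∼-sym (⊗-distribˡ _ _ _))
    derivation-*ₗ c f (x ⊗ y) = ∼-trans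
      (⊕-cong (⊗-congʳ (derivation-*ₗ c f x)) (⊗-congˡ (derivation-*ₗ c f y)))
      (solve 5 (λ c x y dx dy → (c :* dx) :* y :+ x :* (c :* dy) := c :* (dx :* y :+ x :* dy))
        ∼-refl (con c) x y (derivation f x) (derivation f y))

  derivation-isSl₂Action : ∀ {ρ} → IsSl₂Action V ρ → IsSl₂Action space (derivation ∘ ρ)
  derivation-isSl₂Action {ρ} A = record
    { linear = λ x → derivation-linear (A.linear x)
    ; [𝔥,𝔢₊] = λ x → commutes⇒difference space (∼-trans
        (derivation-commutes (λ v → difference⇒commutes V (A.[𝔥,𝔢₊] v)) x)
        (⊕-congˡ (derivation-*ₗ (fromℕ 2) (ρ 𝔢₊) x)))
    ; [𝔥,𝔢₋] = λ x → commutes⇒difference space (∼-trans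
        (derivation-commutes (λ v → difference⇒commutes V (A.[𝔥,𝔢₋] v)) x)
        (⊕-congˡ (derivation-*ₗ (- fromℕ 2) (ρ 𝔢₋) x)))
    ; [𝔢₊,𝔢₋] = λ x → commutes⇒difference space
        (derivation-commutes (λ v → difference⇒commutes V (A.[𝔢₊,𝔢₋] v)) x)
    }
    where module A = IsSl₂Action A

SymmetricPower : ℕ → Sl₂Module → Sl₂Module
SymmetricPower n M = submodule
  (record { space = space ; ρ = derivation ∘ M.ρ ; isSl₂Action = derivation-isSl₂Action M.isSl₂Action })
  {HasDegree n}
  (record { isSubspace = HasDegree-isSubspace n ; ρ-closed = λ x → derivation-HasDegree (M.linear x) })
  where
  module M = Sl₂Module M
  open SymmetricAlgebra M.space

ℚ^ : ℕ → VectorSpace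
ℚ^ k = record
  { Carrierᴹ = Fin k → ℚ
  ; _≈ᴹ_ = λ a b → ∀ j → a j ≡ b j
  ; _+ᴹ_ = λ a b j → a j + b j
  ; _*ₗ_ = λ c a j → c * a j
  ; 0ᴹ = λ _ → 0ℚ
  ; -ᴹ_ = λ a j → - a j
  ; isLeftModule = record
    { isLeftSemimodule = record
      { +ᴹ-isCommutativeMonoid = record
        { isMonoid = record
          { isSemigroup = record
            { isMagma = record
              { isEquivalence = record
                { refl = λ j → refl
                ; sym = λ e j → sym (e j)
                ; trans = λ e e′ j → trans (e j) (e′ j)
                }
              ; ∙-cong = λ e e′ j → cong₂ _+_ (e j) (e′ j)
              }
            ; assoc = λ a b c j → ℚₚ.+-assoc (a j) _ _
            }
          ; identity = (λ a j → ℚₚ.+-identityˡ _) , (λ a j → ℚₚ.+-identityʳ _)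
          }
        ; comm = λ a b j → ℚₚ.+-comm (a j) _
        }
      ; isPreleftSemimodule = record
        { *ₗ-cong = λ e e′ j → cong₂ _*_ e (e′ j)
        ; *ₗ-zeroˡ = λ a j → ℚₚ.*-zeroˡ (a j)
        ; *ₗ-distribʳ = λ a c c′ j → ℚₚ.*-distribʳ-+ (a j) c c′
        ; *ₗ-identityˡ = λ a j → ℚₚ.*-identityˡ (a j)
        ; *ₗ-assoc = λ c c′ a j → ℚₚ.*-assoc c c′ (a j)
        ; *ₗ-zeroʳ = λ c j → ℚₚ.*-zeroʳ c
        ; *ₗ-distribˡ = λ c a b j → ℚₚ.*-distribˡ-+ c (a j) (b j)
        }
      }
    ; -ᴹ‿cong = λ e j → cong -_ (e j)
    ; -ᴹ‿inverse = (λ a j → ℚₚ.+-inverseˡ (a j)) , (λ a j → ℚₚ.+-inverseʳ (a j))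
    }
  }

δ : ℕ → ℕ → ℚ
δ zero    zero    = 1ℚ
δ (suc i) (suc j) = δ i j
δ _       _       = 0ℚ

module _ (d : ℕ) where
  open LeftModule (ℚ^ (suc d))

  -- v i is the i-th basis vector for i ≤ d, and 0 for i > d.
  v : ℕ → Carrierᴹ
  v i j = δ i (toℕ j)

  -- pred 0 = 0 stands in for the index -1; its coefficient is fromℕ 0 = 0.
  ρ-on-basis : Basis-sl₂ → ℕ → Carrierᴹ
  ρ-on-basis 𝔢₊ i = (fromℕ d - fromℕ i) *ₗ v (suc i)
  ρ-on-basis 𝔥  i = (fromℕ 2 * fromℕ i - fromℕ d) *ₗ v i
  ρ-on-basis 𝔢₋ i = fromℕ i *ₗ v (pred i)

  V-ρ : Basis-sl₂ → Carrierᴹ → Carrierᴹ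
  V-ρ x a = linearCombination (ℚ^ (suc d)) a (λ i → ρ-on-basis x (toℕ i))

fromℕ-suc : ∀ k → fromℕ (suc k) ≡ 1ℚ + fromℕ k
fromℕ-suc k = ℚₚ.toℚᵘ-injective (begin
  toℚᵘ (fromℕ (suc k))              ≈⟨ ℚₚ.toℚᵘ-fromℚᵘ (ℚᵘ.mkℚᵘ (+ suc k) 0) ⟩
  ℚᵘ.mkℚᵘ (+ suc k) 0               ≈⟨ ℚᵘ.*≡* (cong (λ l → ((+ 1) ℤ.+ l) ℤ.* (+ 1)) (sym (ℤₚ.*-identityʳ (+ k)))) ⟩
  ℚᵘ.mkℚᵘ (+ 1) 0 ℚᵘ.+ ℚᵘ.mkℚᵘ (+ k) 0
    ≈⟨ ℚᵘₚ.+-congʳ (ℚᵘ.mkℚᵘ (+ 1) 0) (ℚᵘₚ.≃-sym (ℚₚ.toℚᵘ-fromℚᵘ (ℚᵘ.mkℚᵘ (+ k) 0))) ⟩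
  toℚᵘ 1ℚ ℚᵘ.+ toℚᵘ (fromℕ k)       ≈⟨ ℚᵘₚ.≃-sym (ℚₚ.toℚᵘ-homo-+ 1ℚ (fromℕ k)) ⟩
  toℚᵘ (1ℚ + fromℕ k)               ∎)
  where open SetoidReasoning ℚᵘₚ.≃-setoid

module LinearCombination (V : VectorSpace) where
  open LeftModule V
  open MonoidSum +ᴹ-commutativeMonoid using (sum; sum-cong-≋; ∑-distrib-+; sum-replicate-zero)
  open SetoidReasoning ≈ᴹ-setoid

  private
    lc : ∀ {k} → (Fin k → ℚ) → (Fin k → Carrierᴹ) → Carrierᴹ
    lc = linearCombination V

  lc-cong : ∀ {k} {c c′ : Fin k → ℚ} {b b′ : Fin k → Carrierᴹ} →
            (∀ i → c i ≡ c′ i) → (∀ i → b i ≈ᴹ b′ i) → lc c b ≈ᴹ lc c′ b′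
  lc-cong e e′ = sum-cong-≋ (λ i → *ₗ-cong (e i) (e′ i))

  *ₗ-sum : ∀ {k} c (b : Fin k → Carrierᴹ) → c *ₗ sum b ≈ᴹ sum (λ i → c *ₗ b i)
  *ₗ-sum {zero}  c b = *ₗ-zeroʳ c
  *ₗ-sum {suc k} c b = ≈ᴹ-trans (*ₗ-distribˡ c _ _) (+ᴹ-congˡ (*ₗ-sum c (b ∘ suc)))

  lc-+ˡ : ∀ {k} (c c′ : Fin k → ℚ) b → lc (λ i → c i + c′ i) b ≈ᴹ lc c b +ᴹ lc c′ b
  lc-+ˡ c c′ b = ≈ᴹ-trans (sum-cong-≋ (λ i → *ₗ-distribʳ (b i) (c i) (c′ i)))
                          (∑-distrib-+ (λ i → c i *ₗ b i) (λ i → c′ i *ₗ b i))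

  lc-*ˡ : ∀ {k} a (c : Fin k → ℚ) b → lc (λ i → a * c i) b ≈ᴹ a *ₗ lc c b
  lc-*ˡ a c b = ≈ᴹ-trans (sum-cong-≋ (λ i → *ₗ-assoc a (c i) (b i)))
                         (≈ᴹ-sym (*ₗ-sum a (λ i → c i *ₗ b i)))

  lc-+ʳ : ∀ {k} (c : Fin k → ℚ) b b′ → lc c (λ i → b i +ᴹ b′ i) ≈ᴹ lc c b +ᴹ lc c b′
  lc-+ʳ c b b′ = ≈ᴹ-trans (sum-cong-≋ (λ i → *ₗ-distribˡ (c i) (b i) (b′ i)))
                          (∑-distrib-+ (λ i → c i *ₗ b i) (λ i → c i *ₗ b′ i))

  lc-*ʳ : ∀ {k} a (c : Fin k → ℚ) b → lc c (λ i → a *ₗ b i) ≈ᴹ a *ₗ lc c b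
  lc-*ʳ a c b = ≈ᴹ-trans (sum-cong-≋ swap) (≈ᴹ-sym (*ₗ-sum a (λ i → c i *ₗ b i)))
    where
    swap : ∀ i → c i *ₗ (a *ₗ b i) ≈ᴹ a *ₗ (c i *ₗ b i)
    swap i = begin
      c i *ₗ (a *ₗ b i)    ≈⟨ ≈ᴹ-sym (*ₗ-assoc (c i) a (b i)) ⟩
      (c i * a) *ₗ b i     ≈⟨ *ₗ-congʳ (ℚₚ.*-comm (c i) a) ⟩
      (a * c i) *ₗ b i     ≈⟨ *ₗ-assoc a (c i) (b i) ⟩
      a *ₗ (c i *ₗ b i)    ∎

  lc-zero : ∀ {k} (b : Fin k → Carrierᴹ) → lc (λ _ → 0ℚ) b ≈ᴹ 0ᴹ
  lc-zero {k} b = ≈ᴹ-trans (sum-cong-≋ (λ i → *ₗ-zeroˡ (b i))) (sum-replicate-zero k)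

  lc-δ : ∀ {k} (i : Fin k) b → lc (λ j → δ (toℕ i) (toℕ j)) b ≈ᴹ b i
  lc-δ zero    b = ≈ᴹ-trans (+ᴹ-cong (*ₗ-identityˡ (b zero)) (lc-zero (b ∘ suc))) (+ᴹ-identityʳ _)
  lc-δ (suc i) b = ≈ᴹ-trans (+ᴹ-cong (*ₗ-zeroˡ (b zero)) (lc-δ i (b ∘ suc))) (+ᴹ-identityˡ _)

linear-lc : (U V : VectorSpace) → ∀ {f} → IsLinear U V f → ∀ {k} (c : Fin k → ℚ) b →
            LeftModule._≈ᴹ_ V (f (linearCombination U c b)) (linearCombination V c (f ∘ b))
linear-lc U V L {zero}  c b = LeftModuleMorphisms.IsLeftModuleHomomorphism.0ᴹ-homo L
linear-lc U V L {suc k} c b = ≈ᴹ-trans (linear-+ U V L _ _)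
  (+ᴹ-cong (linear-*ₗ U V L (c zero) (b zero)) (linear-lc U V L (c ∘ suc) (b ∘ suc)))
  where open LeftModule V

V-isSl₂Action : ∀ d → IsSl₂Action (ℚ^ (suc d)) (V-ρ d)
V-isSl₂Action d = record
  { linear = ρ-linear
  ; [𝔥,𝔢₊] = λ a → commutes⇒difference W (relation 𝔥 𝔢₊ 𝔢₊ (fromℕ 2) h-e₊ a)
  ; [𝔥,𝔢₋] = λ a → commutes⇒difference W (relation 𝔥 𝔢₋ 𝔢₋ (- fromℕ 2) h-e₋ a)
  ; [𝔢₊,𝔢₋] = λ a → commutes⇒difference W
      (≈ᴹ-trans (relation 𝔢₊ 𝔢₋ 𝔥 1ℚ e₊-e₋ a) (+ᴹ-congˡ {V-ρ d 𝔢₋ (V-ρ d 𝔢₊ a)} (*ₗ-identityˡ (V-ρ d 𝔥 a))))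
  }
  where
  W = ℚ^ (suc d)
  open LeftModule W
  open LinearCombination W
  open SetoidReasoning ≈ᴹ-setoid
  open ℚSolver.+-*-Solver using (solve; _:+_; _:*_; _:-_; :-_; _:=_) renaming (con to K)

  ρ = V-ρ d
  B = ρ-on-basis d
  D = fromℕ d

  ρ-linear : ∀ x → IsLinear W W (ρ x)
  ρ-linear x = mkLinear W W (ρ x)
    (λ e → lc-cong e (λ i → ≈ᴹ-refl {B x (toℕ i)}))
    (λ a b → lc-+ˡ a b (B x ∘ toℕ))
    (λ c a → lc-*ˡ c a (B x ∘ toℕ))

  relation : ∀ x y z c →
    (∀ (i : Fin (suc d)) → ρ x (B y (toℕ i)) ≈ᴹ ρ y (B x (toℕ i)) +ᴹ c *ₗ B z (toℕ i)) →
    ∀ a → ρ x (ρ y a) ≈ᴹ ρ y (ρ x a) +ᴹ c *ₗ ρ z a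
  relation x y z c eq a = begin
    ρ x (ρ y a)
      ≈⟨ linear-lc W W (ρ-linear x) a (B y ∘ toℕ) ⟩
    linearCombination W a (λ i → ρ x (B y (toℕ i)))
      ≈⟨ lc-cong {c = a} (λ _ → refl) eq ⟩
    linearCombination W a (λ i → ρ y (B x (toℕ i)) +ᴹ c *ₗ B z (toℕ i))
      ≈⟨ lc-+ʳ a (λ i → ρ y (B x (toℕ i))) (λ i → c *ₗ B z (toℕ i)) ⟩
    linearCombination W a (λ i → ρ y (B x (toℕ i))) +ᴹ linearCombination W a (λ i → c *ₗ B z (toℕ i))
      ≈⟨ +ᴹ-cong (≈ᴹ-sym (linear-lc W W (ρ-linear y) a (B x ∘ toℕ))) (lc-*ʳ c a (B z ∘ toℕ)) ⟩
    ρ y (ρ x a) +ᴹ c *ₗ ρ z a ∎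

  ρ-v : ∀ x {i} → i < suc d → ρ x (v d i) ≈ᴹ B x i
  ρ-v x {i} i< = subst (λ k → ρ x (v d k) ≈ᴹ B x k) (Finₚ.toℕ-fromℕ< i<)
    (lc-δ (Fin.fromℕ< i<) (B x ∘ toℕ))

  ρ-scaled-v : ∀ x c {i} → i < suc d → ρ x (c *ₗ v d i) ≈ᴹ c *ₗ B x i
  ρ-scaled-v x c {i} i< = ≈ᴹ-trans (linear-*ₗ W W (ρ-linear x) c (v d i)) (*ₗ-congˡ {c} (ρ-v x i<))

  -- For i = d both sides vanish, although v (suc d) = 0 does not match
  -- the formula for the action.
  ρ-e₊ : ∀ x (i : Fin (suc d)) → ρ x (B 𝔢₊ (toℕ i)) ≈ᴹ (D - fromℕ (toℕ i)) *ₗ B x (suc (toℕ i))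
  ρ-e₊ x i with ℕₚ.m≤n⇒m<n∨m≡n (Finₚ.toℕ≤pred[n] i)
  ... | inj₁ i<d = ρ-scaled-v x (D - fromℕ (toℕ i)) (s≤s i<d)
  ... | inj₂ i≡d = begin
    ρ x ((D - I) *ₗ v d (suc (toℕ i)))     ≈⟨ linear-*ₗ W W (ρ-linear x) (D - I) (v d (suc (toℕ i))) ⟩
    (D - I) *ₗ ρ x (v d (suc (toℕ i)))     ≈⟨ *ₗ-congʳ {ρ x (v d (suc (toℕ i)))} vanish ⟩
    0ℚ *ₗ ρ x (v d (suc (toℕ i)))          ≈⟨ *ₗ-zeroˡ (ρ x (v d (suc (toℕ i)))) ⟩
    0ᴹ                                     ≈⟨ ≈ᴹ-sym (*ₗ-zeroˡ (B x (suc (toℕ i)))) ⟩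
    0ℚ *ₗ B x (suc (toℕ i))                ≈⟨ *ₗ-congʳ {B x (suc (toℕ i))} (sym vanish) ⟩
    (D - I) *ₗ B x (suc (toℕ i))           ∎
    where
    I = fromℕ (toℕ i)
    vanish : D - I ≡ 0ℚ
    vanish = trans (cong (λ k → D - fromℕ k) i≡d) (ℚₚ.+-inverseʳ D)

  h-e₊ : ∀ (i : Fin (suc d)) → ρ 𝔥 (B 𝔢₊ (toℕ i)) ≈ᴹ ρ 𝔢₊ (B 𝔥 (toℕ i)) +ᴹ fromℕ 2 *ₗ B 𝔢₊ (toℕ i)
  h-e₊ i j = trans (ρ-e₊ 𝔥 i j) (trans
    (trans (cong (λ s → (D - I) * ((fromℕ 2 * s - D) * w)) (fromℕ-suc (toℕ i)))
      (solve 3 (λ D I w → (D :- I) :* ((K (fromℕ 2) :* (K 1ℚ :+ I) :- D) :* w)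
                   := (K (fromℕ 2) :* I :- D) :* ((D :- I) :* w) :+ K (fromℕ 2) :* ((D :- I) :* w))
        refl D I w))
    (cong (_+ fromℕ 2 * ((D - I) * w)) (sym (ρ-scaled-v 𝔢₊ (fromℕ 2 * I - D) (Finₚ.toℕ<n i) j))))
    where
    I = fromℕ (toℕ i)
    w = v d (suc (toℕ i)) j

  h-e₋ : ∀ (i : Fin (suc d)) → ρ 𝔥 (B 𝔢₋ (toℕ i)) ≈ᴹ ρ 𝔢₋ (B 𝔥 (toℕ i)) +ᴹ (- fromℕ 2) *ₗ B 𝔢₋ (toℕ i)
  h-e₋ i j = trans (ρ-scaled-v 𝔥 (fromℕ (toℕ i)) (ℕₚ.≤-<-trans ℕₚ.pred[n]≤n (Finₚ.toℕ<n i)) j)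
    (trans (identity (toℕ i)) (cong (_+ (- fromℕ 2) * B 𝔢₋ (toℕ i) j) (sym (ρ-scaled-v 𝔢₋ (fromℕ 2 * fromℕ (toℕ i) - D) (Finₚ.toℕ<n i) j))))
    where
    identity : ∀ k →
      fromℕ k * ((fromℕ 2 * fromℕ (pred k) - D) * v d (pred k) j)
      ≡ (fromℕ 2 * fromℕ k - D) * (fromℕ k * v d (pred k) j) + (- fromℕ 2) * (fromℕ k * v d (pred k) j)
    identity zero = solve 2 (λ D w →
      K 0ℚ :* ((K (fromℕ 2) :* K 0ℚ :- D) :* w)
      := (K (fromℕ 2) :* K 0ℚ :- D) :* (K 0ℚ :* w) :+ (:- K (fromℕ 2)) :* (K 0ℚ :* w))
      refl D (v d 0 j)
    identity (suc k) rewrite fromℕ-suc k = solve 3 (λ D k w →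
      (K 1ℚ :+ k) :* ((K (fromℕ 2) :* k :- D) :* w)
      := (K (fromℕ 2) :* (K 1ℚ :+ k) :- D) :* ((K 1ℚ :+ k) :* w) :+ (:- K (fromℕ 2)) :* ((K 1ℚ :+ k) :* w))
      refl D (fromℕ k) (v d k j)

  e₊-e₋ : ∀ (i : Fin (suc d)) → ρ 𝔢₊ (B 𝔢₋ (toℕ i)) ≈ᴹ ρ 𝔢₋ (B 𝔢₊ (toℕ i)) +ᴹ 1ℚ *ₗ B 𝔥 (toℕ i)
  e₊-e₋ i j = trans (ρ-scaled-v 𝔢₊ (fromℕ (toℕ i)) (ℕₚ.≤-<-trans ℕₚ.pred[n]≤n (Finₚ.toℕ<n i)) j)
    (trans (identity (toℕ i)) (cong (_+ 1ℚ * B 𝔥 (toℕ i) j) (sym (ρ-e₊ 𝔢₋ i j))))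
    where
    identity : ∀ k →
      fromℕ k * ((D - fromℕ (pred k)) * v d (suc (pred k)) j)
      ≡ (D - fromℕ k) * (fromℕ (suc k) * v d k j) + 1ℚ * ((fromℕ 2 * fromℕ k - D) * v d k j)
    identity zero = solve 3 (λ D w w′ →
      K 0ℚ :* ((D :- K 0ℚ) :* w′)
      := (D :- K 0ℚ) :* (K 1ℚ :* w) :+ K 1ℚ :* ((K (fromℕ 2) :* K 0ℚ :- D) :* w))
      refl D (v d 0 j) (v d 1 j)
    identity (suc k) rewrite fromℕ-suc (suc k) | fromℕ-suc k = solve 3 (λ D k w →
      (K 1ℚ :+ k) :* ((D :- k) :* w)
      := (D :- (K 1ℚ :+ k)) :* ((K 1ℚ :+ (K 1ℚ :+ k)) :* w)
         :+ K 1ℚ :* ((K (fromℕ 2) :* (K 1ℚ :+ k) :- D) :* w))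
      refl D (fromℕ k) (v d (suc k) j)

V : ℕ → Sl₂Module
V d = record { space = ℚ^ (suc d) ; ρ = V-ρ d ; isSl₂Action = V-isSl₂Action d }

{-# OPTIONS --safe #-}

-- Send a symmetric polynomial p of degree ≤ d in each variable to
-- T p = Σ_m p_m · v_{m₁} ⋯ v_{mₙ} ∈ Symⁿ(V_d), the sum running over m ∈ {0,…,d}ⁿ.  In the other
-- direction, the universal property of the symmetric algebra gives an algebra map ⟦_⟧ into the
-- commutative algebra of ℚ-valued functions on words in ℕ with the shuffle product; on Symⁿ(V_d) it
-- takes w₁ ⋯ wₙ to the symmetrization Σ_σ ∏ₖ w_{σ k} of w₁ ⊗ ⋯ ⊗ wₙ.  Deleting the first letter i
-- is a derivation ∂ᵢ of the shuffle algebra, and Euler's identity Σᵢ vᵢ ∂ᵢ = n in degree n shows by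
-- induction that T and ⟦_⟧ are inverse to each other up to the factor n!.
--
-- On words, diffOp x acts by a formula on one letter at a time, hence as a derivation for shuffles;
-- so ⟦_⟧ is equivariant, and therefore so is T.

module Submission where

open import Defs
open import Data.Nat.Base using (ℕ; _≤_)
open import Data.Product.Base using (Σ-syntax; _×_; _,_; proj₁)

open import Algebra.Bundles using (CommutativeRing; CommutativeSemiring)
open import Algebra.Module.Bundles using (LeftModule)
import Algebra.Properties.CommutativeMonoid.Sum as MonoidSum
import Algebra.Properties.Semiring.Sum as SemiringSum
import Algebra.Solver.Ring.NaturalCoefficients.Default as SemiringSolver
open import Data.Bool.Base using (if_then_else_)
open import Data.Fin.Base as Fin using (Fin; zero; suc; toℕ)
open import Data.Fin.Permutation as Perm using (Permutation′; _⟨$⟩ʳ_)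
import Data.Fin.Properties as Finₚ
open import Data.List.Base as List using (List; upTo; cartesianProductWith; deduplicate)
import Data.List.Membership.DecPropositional as DecMembership
open import Data.List.Membership.Propositional using (_∈_; _∉_)
import Data.List.Membership.Propositional.Properties as ∈ₚ
import Data.List.Relation.Unary.All as All
import Data.List.Relation.Unary.Any as Any
import Data.List.Relation.Unary.Any.Properties as Anyₚ
import Data.List.Relation.Unary.Unique.DecPropositional.Properties as DecUniqueₚ
open import Data.List.Relation.Unary.Unique.Propositional using (Unique; _∷_)
open import Data.Nat.Base as ℕ using (zero; suc; pred; _<_; s≤s; z≤n; _⊔_)
import Data.Nat.Properties as ℕₚ
open import Data.Product.Base using (∃-syntax)
open import Data.Rational.Base using (ℚ; 0ℚ; 1ℚ; _+_; _*_; _-_; -_; 1/_; NonZero)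
import Data.Rational.Properties as ℚₚ
import Data.Rational.Solver as ℚSolver
open import Data.Sum.Base using (inj₁; inj₂)
open import Data.Vec.Base using (Vec; []; _∷_; lookup; tabulate)
import Data.Vec.Properties as Vecₚ
open import Function.Base using (_∘_)
open import Relation.Binary.Definitions using (DecidableEquality; tri<; tri≈; tri>)
open import Relation.Binary.PropositionalEquality
  using (_≡_; _≢_; refl; sym; trans; cong; cong₂; subst; module ≡-Reasoning)
import Relation.Binary.Reasoning.Setoid as SetoidReasoning
open import Relation.Nullary using (yes; no; contradiction; does)

open SemiringSum (CommutativeRing.semiring ℚₚ.+-*-commutativeRing) using ()
  renaming ( sum to ∑; sum-cong-≋ to ∑-cong; sum-replicate-zero to ∑-zero
           ; ∑-distrib-+ to ∑-+; *-distribˡ-sum to *-distribˡ-∑)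
open ℚSolver.+-*-Solver using (solve; _:+_; _:*_; _:-_; :-_; _:=_) renaming (con to K)

-- For n = 1 the operators send x^i to (d - i) x^(i+1), (2i - d) x^i and i x^(i-1). Hence v_i ↔ x^i
-- identifies V_d with the polynomials of degree at most d in one variable, and its n-th tensor
-- power with those of degree at most d in each of n variables. The theorem compares the invariants
-- of that tensor power under permutation of the factors with its coinvariants Symⁿ(V_d); in
-- characteristic 0 they agree because n! is invertible. The obstacle is that `Sym` consists of
-- terms modulo a generated congruence, so injectivity of a map into it cannot be read off from the
-- terms: a model is needed that tells them apart. The shuffle algebra is such a model, and its
-- recursion on the first letter turns the computations into Leibniz rules. Letters range over all
-- of ℕ so that the same `act` describes arbitrary polynomials and V_d; the bound d is a separate
-- vanishing condition.

infix 8 _⟨_⟩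

_⟨_⟩ : ∀ {n} {A : Set} → (Vec ℕ (suc n) → A) → ℕ → Vec ℕ n → A
(f ⟨ i ⟩) w = f (i ∷ w)

-- Adjacent transpositions

infix 4 _⇝_

-- `act` and `ш` recurse on the first letter, so invariance under these generators only has to be
-- checked for a swap of the first two letters and, by induction, behind a common first letter.
data _⇝_ : ∀ {n} → Vec ℕ n → Vec ℕ n → Set where
  swap : ∀ {n} i j (w : Vec ℕ n) → i ∷ j ∷ w ⇝ j ∷ i ∷ w
  prep : ∀ {n} i {w w′ : Vec ℕ n} → w ⇝ w′ → i ∷ w ⇝ i ∷ w′

SwapInvariant : ∀ {n} {A : Set} → (Vec ℕ n → A) → Set
SwapInvariant f = ∀ {w w′} → w ⇝ w′ → f w ≡ f w′

⟨⟩-swapInvariant : ∀ {n} {A : Set} {f : Vec ℕ (suc n) → A} →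
                   SwapInvariant f → ∀ i → SwapInvariant (f ⟨ i ⟩)
⟨⟩-swapInvariant f-inv i r = f-inv (prep i r)

private
  -- The letter at place k passes its left neighbours one by one: a swap exchanges it with `g zero`,
  -- and the induction continues behind `g zero`.
  toFront : ∀ {n} {A : Set} {f : Vec ℕ (suc n) → A} → SwapInvariant f → ∀ (g : Fin (suc n) → ℕ) k →
            f (g k ∷ tabulate (g ∘ Fin.punchIn k)) ≡ f (tabulate g)
  toFront f-inv g zero = refl
  toFront {suc n} f-inv g (suc k) = trans (f-inv (swap _ _ _))
    (toFront (⟨⟩-swapInvariant f-inv (g zero)) (g ∘ suc) k)

-- A permutation is the image k of the first place together with the induced permutation of the
-- remaining places. Induction undoes the latter behind the letter `g k`, and `toFront` returns that
-- letter to its place.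
swapInvariant-permute : ∀ {n} {A : Set} {f : Vec ℕ n → A} → SwapInvariant f →
  ∀ (σ : Permutation′ n) g → f (tabulate (g ∘ (σ ⟨$⟩ʳ_))) ≡ f (tabulate g)
swapInvariant-permute {zero} f-inv σ g = refl
swapInvariant-permute {suc n} {f = f} f-inv σ g = begin
  f (tabulate (g ∘ (σ ⟨$⟩ʳ_)))
    ≡⟨ cong (λ w → f (g k ∷ w)) (Vecₚ.tabulate-cong (λ j → cong g (Perm.punchIn-permute σ zero j))) ⟩
  f (g k ∷ tabulate (g ∘ Fin.punchIn k ∘ (Perm.remove zero σ ⟨$⟩ʳ_)))
    ≡⟨ swapInvariant-permute (⟨⟩-swapInvariant f-inv (g k)) (Perm.remove zero σ) (g ∘ Fin.punchIn k) ⟩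
  f (g k ∷ tabulate (g ∘ Fin.punchIn k))
    ≡⟨ toFront f-inv g k ⟩
  f (tabulate g) ∎
  where
  open ≡-Reasoning
  k = σ ⟨$⟩ʳ zero

⇝-permutation : ∀ {n} {w w′ : Vec ℕ n} → w ⇝ w′ →
                Σ[ σ ∈ Permutation′ n ] tabulate (λ k → lookup w (σ ⟨$⟩ʳ k)) ≡ w′
⇝-permutation (swap i j w) = Perm.swap Perm.id , cong (λ u → j ∷ i ∷ u) (Vecₚ.tabulate∘lookup w)
⇝-permutation (prep i r) with σ , e ← ⇝-permutation r = Perm.lift₀ σ , cong (i ∷_) e

symmetric⇒swapInvariant : ∀ {n} (p : Polynomial n) → Symmetric p → SwapInvariant (coeff p)
symmetric⇒swapInvariant p p-sym {w} r with σ , e ← ⇝-permutation r =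
  trans (sym (p-sym σ w)) (cong (coeff p) e)

swapInvariant⇒symmetric : ∀ {n} (p : Polynomial n) → SwapInvariant (coeff p) → Symmetric p
swapInvariant⇒symmetric p p-inv σ m =
  trans (swapInvariant-permute p-inv σ (lookup m)) (cong (coeff p) (Vecₚ.tabulate∘lookup m))

-- The action on coefficients

fromℕ-+ : ∀ k l → fromℕ (k ℕ.+ l) ≡ fromℕ k + fromℕ l
fromℕ-+ zero    l = sym (ℚₚ.+-identityˡ _)
fromℕ-+ (suc k) l = begin
  fromℕ (suc (k ℕ.+ l))         ≡⟨ fromℕ-suc (k ℕ.+ l) ⟩
  1ℚ + fromℕ (k ℕ.+ l)          ≡⟨ cong (1ℚ +_) (fromℕ-+ k l) ⟩
  1ℚ + (fromℕ k + fromℕ l)      ≡⟨ ℚₚ.+-assoc 1ℚ (fromℕ k) (fromℕ l) ⟨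
  (1ℚ + fromℕ k) + fromℕ l      ≡⟨ cong (_+ fromℕ l) (fromℕ-suc k) ⟨
  fromℕ (suc k) + fromℕ l       ∎
  where open ≡-Reasoning

-- The contrapositive of `DegreeInEachVariable≤`: a vanishing statement passes through sums and
-- products. Obtaining it from the degree condition uses that equality in ℚ is decidable.
Bounded : ∀ {n} → ℕ → (Vec ℕ n → ℚ) → Set
Bounded d f = ∀ m k → d < lookup m k → f m ≡ 0ℚ

degree≤⇒bounded : ∀ {n d} (p : Polynomial n) → DegreeInEachVariable≤ d p → Bounded d (coeff p)
degree≤⇒bounded p p≤ m k d<m with coeff p m ℚₚ.≟ 0ℚ
... | yes e = e
... | no  e = contradiction (p≤ m e k) (ℕₚ.<⇒≱ d<m)

bounded⇒degree≤ : ∀ {n d} (p : Polynomial n) → Bounded d (coeff p) → DegreeInEachVariable≤ d p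
bounded⇒degree≤ p p-bd m e k = ℕₚ.≮⇒≥ (λ d<m → e (p-bd m k d<m))

⟨⟩-bounded : ∀ {n d} {f : Vec ℕ (suc n) → ℚ} → Bounded d f → ∀ i → Bounded d (f ⟨ i ⟩)
⟨⟩-bounded f-bd i m k = f-bd (i ∷ m) (suc k)

module _ (d : ℕ) where
  private
    D = fromℕ d

  -- On power series in one variable, x sends Σ gᵢ tⁱ to Σ factor x i · g (shift x i) tⁱ.
  shift : Basis-sl₂ → ℕ → ℕ
  shift 𝔢₊ = pred
  shift 𝔥  = λ i → i
  shift 𝔢₋ = suc

  factor : Basis-sl₂ → ℕ → ℚ
  -- No power of t is raised to t^0; the factor 0 also makes the stand-in index `pred 0 = 0`
  -- harmless.
  factor 𝔢₊ zero    = 0ℚ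
  factor 𝔢₊ (suc i) = D - fromℕ i
  factor 𝔥  i       = fromℕ 2 * fromℕ i - D
  factor 𝔢₋ i       = fromℕ (suc i)

  act₁ : Basis-sl₂ → (ℕ → ℚ) → ℕ → ℚ
  act₁ x g i = factor x i * g (shift x i)

  act : ∀ {n} → Basis-sl₂ → (Vec ℕ n → ℚ) → Vec ℕ n → ℚ
  act x f []      = 0ℚ
  act x f (i ∷ w) = act₁ x (λ j → f (j ∷ w)) i + act x (f ⟨ i ⟩) w

  act-cong : ∀ {n} x {f g : Vec ℕ n → ℚ} → (∀ w → f w ≡ g w) → ∀ w → act x f w ≡ act x g w
  act-cong x e []      = refl
  act-cong x e (i ∷ w) = cong₂ _+_ (cong (factor x i *_) (e _)) (act-cong x (λ u → e (i ∷ u)) w)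

  act-+ : ∀ {n} x (f g : Vec ℕ n → ℚ) w →
             act x (λ u → f u + g u) w ≡ act x f w + act x g w
  act-+ x f g []      = refl
  act-+ x f g (i ∷ w) = trans
    (cong (factor x i * (f (shift x i ∷ w) + g (shift x i ∷ w)) +_) (act-+ x (f ⟨ i ⟩) (g ⟨ i ⟩) w))
    (solve 5 (λ a f g F G → a :* (f :+ g) :+ (F :+ G) := (a :* f :+ F) :+ (a :* g :+ G))
      refl (factor x i) (f (shift x i ∷ w)) (g (shift x i ∷ w))
      (act x (f ⟨ i ⟩) w) (act x (g ⟨ i ⟩) w))

  act-* : ∀ {n} x c (f : Vec ℕ n → ℚ) w → act x (λ u → c * f u) w ≡ c * act x f w
  act-* x c f []      = sym (ℚₚ.*-zeroʳ c)
  act-* x c f (i ∷ w) = trans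
    (cong (factor x i * (c * f (shift x i ∷ w)) +_) (act-* x c (f ⟨ i ⟩) w))
    (solve 4 (λ a c f F → a :* (c :* f) :+ c :* F := c :* (a :* f :+ F))
      refl (factor x i) c (f (shift x i ∷ w)) (act x (f ⟨ i ⟩) w))

  act-zero : ∀ {n} x {f : Vec ℕ n → ℚ} → (∀ w → f w ≡ 0ℚ) → ∀ w → act x f w ≡ 0ℚ
  act-zero x e []      = refl
  act-zero x e (i ∷ w) = cong₂ _+_
    (trans (cong (factor x i *_) (e _)) (ℚₚ.*-zeroʳ (factor x i))) (act-zero x (λ u → e (i ∷ u)) w)

  act-swapInvariant : ∀ {n} x {f : Vec ℕ n → ℚ} → SwapInvariant f → SwapInvariant (act x f)
  act-swapInvariant x {f} f-inv (swap i j w) = begin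
    a * f (s i ∷ j ∷ w) + (b * f (i ∷ s j ∷ w) + act x (f ⟨ i ⟩ ⟨ j ⟩) w)
      ≡⟨ cong₂ _+_ (cong (a *_) (f-inv (swap _ _ _)))
           (cong₂ _+_ (cong (b *_) (f-inv (swap _ _ _))) (act-cong x (λ u → f-inv (swap i j u)) w)) ⟩
    a * f (j ∷ s i ∷ w) + (b * f (s j ∷ i ∷ w) + act x (f ⟨ j ⟩ ⟨ i ⟩) w)
      ≡⟨ solve 3 (λ x y z → x :+ (y :+ z) := y :+ (x :+ z)) refl
           (a * f (j ∷ s i ∷ w)) (b * f (s j ∷ i ∷ w)) (act x (f ⟨ j ⟩ ⟨ i ⟩) w) ⟩
    b * f (s j ∷ i ∷ w) + (a * f (j ∷ s i ∷ w) + act x (f ⟨ j ⟩ ⟨ i ⟩) w) ∎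
    where
    open ≡-Reasoning
    s = shift x
    a = factor x i
    b = factor x j
  act-swapInvariant x {f} f-inv (prep i r) = cong₂ _+_
    (cong (factor x i *_) (f-inv (prep _ r))) (act-swapInvariant x (⟨⟩-swapInvariant f-inv i) r)

  -- Only `𝔢₊` raises the degree, and t^d contributes to t^(d+1) with the factor `D - fromℕ d`,
  -- which is zero. Here the constant d of the action has to match the degree bound.
  act₁-bounded : ∀ x {g : ℕ → ℚ} → (∀ i → d < i → g i ≡ 0ℚ) → ∀ i → d < i → act₁ x g i ≡ 0ℚ
  act₁-bounded 𝔢₊ {g} g-bd (suc i) (s≤s d≤i) with ℕₚ.m≤n⇒m<n∨m≡n d≤i
  ... | inj₁ d<i  = trans (cong ((D - fromℕ i) *_) (g-bd i d<i)) (ℚₚ.*-zeroʳ (D - fromℕ i))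
  ... | inj₂ refl = trans (cong (_* g i) (ℚₚ.+-inverseʳ D)) (ℚₚ.*-zeroˡ (g i))
  act₁-bounded 𝔥  g-bd i d<i = trans (cong (factor 𝔥 i *_) (g-bd i d<i)) (ℚₚ.*-zeroʳ (factor 𝔥 i))
  act₁-bounded 𝔢₋ g-bd i d<i =
    trans (cong (factor 𝔢₋ i *_) (g-bd (suc i) (ℕₚ.m≤n⇒m≤1+n d<i))) (ℚₚ.*-zeroʳ (factor 𝔢₋ i))

  act-bounded : ∀ {n} x {f : Vec ℕ n → ℚ} → Bounded d f → Bounded d (act x f)
  act-bounded x f-bd (i ∷ w) zero d<i = cong₂ _+_
    (act₁-bounded x (λ j → f-bd (j ∷ w) zero) i d<i)
    (act-zero x (λ u → f-bd (i ∷ u) zero d<i) w)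
  act-bounded x f-bd (i ∷ w) (suc k) d<m = cong₂ _+_
    (trans (cong (factor x i *_) (f-bd _ (suc k) d<m)) (ℚₚ.*-zeroʳ (factor x i)))
    (act-bounded x (⟨⟩-bounded f-bd i) w k d<m)

  -- Operators applied to different letters commute, so only the terms in which both hit the same
  -- letter survive in the commutator. The relation therefore reduces to one variable.
  act-commutes : ∀ x y z c →
    (∀ g i → act₁ x (act₁ y g) i ≡ act₁ y (act₁ x g) i + c * act₁ z g i) →
    ∀ {n} (f : Vec ℕ n → ℚ) w → act x (act y f) w ≡ act y (act x f) w + c * act z f w
  act-commutes x y z c eq f []      = sym (trans (ℚₚ.+-identityˡ (c * 0ℚ)) (ℚₚ.*-zeroʳ c))
  act-commutes x y z c eq f (i ∷ w) = begin
    a * (b′ + act y (f ⟨ shift x i ⟩) w) + act x (λ u → b * f (shift y i ∷ u) + act y (f ⟨ i ⟩) u) w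
      ≡⟨ cong (a * (b′ + Y) +_) (expand x y) ⟩
    a * (b′ + Y) + (b * X + act x (act y (f ⟨ i ⟩)) w)
      ≡⟨ cong (λ t → a * (b′ + Y) + (b * X + t)) (act-commutes x y z c eq (f ⟨ i ⟩) w) ⟩
    a * (b′ + Y) + (b * X + (YX + c * Z))
      ≡⟨ solve 8 (λ a b b′ X Y YX c Z →
            a :* (b′ :+ Y) :+ (b :* X :+ (YX :+ c :* Z))
            := a :* b′ :+ (b :* X :+ (a :* Y :+ YX) :+ c :* Z)) refl a b b′ X Y YX c Z ⟩
    a * b′ + (b * X + (a * Y + YX) + c * Z)
      ≡⟨ cong (_+ (b * X + (a * Y + YX) + c * Z)) (eq g i) ⟩
    (b * a′ + c * z′) + (b * X + (a * Y + YX) + c * Z)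
      ≡⟨ solve 8 (λ b a′ c z′ X T Z U →
            (b :* a′ :+ c :* z′) :+ (b :* X :+ T :+ c :* Z)
            := (b :* (a′ :+ X) :+ T) :+ c :* (z′ :+ Z)) refl b a′ c z′ X (a * Y + YX) Z Z ⟩
    (b * (a′ + X) + (a * Y + YX)) + c * (z′ + Z)
      ≡⟨ cong (λ t → (b * (a′ + X) + t) + c * (z′ + Z)) (expand y x) ⟨
    (b * (a′ + X) + act y (λ u → a * f (shift x i ∷ u) + act x (f ⟨ i ⟩) u) w) + c * (z′ + Z) ∎
    where
    open ≡-Reasoning
    g = λ j → f (j ∷ w)
    a = factor x i
    b = factor y i
    b′ = act₁ y g (shift x i)
    a′ = act₁ x g (shift y i)
    z′ = act₁ z g i
    X = act x (f ⟨ shift y i ⟩) w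
    Y = act y (f ⟨ shift x i ⟩) w
    Z = act z (f ⟨ i ⟩) w
    YX = act y (act x (f ⟨ i ⟩)) w
    expand : ∀ x y → act x (λ u → factor y i * f (shift y i ∷ u) + act y (f ⟨ i ⟩) u) w
                   ≡ factor y i * act x (f ⟨ shift y i ⟩) w + act x (act y (f ⟨ i ⟩)) w
    expand x y = trans (act-+ x (λ u → factor y i * f (shift y i ∷ u)) (act y (f ⟨ i ⟩)) w)
      (cong (_+ act x (act y (f ⟨ i ⟩)) w) (act-* x (factor y i) (f ⟨ shift y i ⟩) w))

  private
    [𝔥,𝔢₊]₁ : ∀ g i → act₁ 𝔥 (act₁ 𝔢₊ g) i ≡ act₁ 𝔢₊ (act₁ 𝔥 g) i + fromℕ 2 * act₁ 𝔢₊ g i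
    [𝔥,𝔢₊]₁ g zero = solve 2 (λ D g →
      (K (fromℕ 2) :* K 0ℚ :- D) :* (K 0ℚ :* g)
      := K 0ℚ :* ((K (fromℕ 2) :* K 0ℚ :- D) :* g) :+ K (fromℕ 2) :* (K 0ℚ :* g)) refl D (g 0)
    [𝔥,𝔢₊]₁ g (suc i) rewrite fromℕ-suc i = solve 3 (λ D i g →
      (K (fromℕ 2) :* (K 1ℚ :+ i) :- D) :* ((D :- i) :* g)
      := (D :- i) :* ((K (fromℕ 2) :* i :- D) :* g) :+ K (fromℕ 2) :* ((D :- i) :* g)) refl D (fromℕ i) (g i)

    [𝔥,𝔢₋]₁ : ∀ g i → act₁ 𝔥 (act₁ 𝔢₋ g) i ≡ act₁ 𝔢₋ (act₁ 𝔥 g) i + (- fromℕ 2) * act₁ 𝔢₋ g i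
    [𝔥,𝔢₋]₁ g i rewrite fromℕ-suc i = solve 3 (λ D i g →
      (K (fromℕ 2) :* i :- D) :* ((K 1ℚ :+ i) :* g)
      := (K 1ℚ :+ i) :* ((K (fromℕ 2) :* (K 1ℚ :+ i) :- D) :* g) :+ (:- K (fromℕ 2)) :* ((K 1ℚ :+ i) :* g))
      refl D (fromℕ i) (g (suc i))

    [𝔢₊,𝔢₋]₁ : ∀ g i → act₁ 𝔢₊ (act₁ 𝔢₋ g) i ≡ act₁ 𝔢₋ (act₁ 𝔢₊ g) i + 1ℚ * act₁ 𝔥 g i
    [𝔢₊,𝔢₋]₁ g zero = solve 3 (λ D g g₁ →
      K 0ℚ :* (K 1ℚ :* g₁) := K 1ℚ :* ((D :- K 0ℚ) :* g) :+ K 1ℚ :* ((K (fromℕ 2) :* K 0ℚ :- D) :* g))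
      refl D (g 0) (g 1)
    [𝔢₊,𝔢₋]₁ g (suc i) rewrite fromℕ-suc (suc i) | fromℕ-suc i = solve 3 (λ D i g →
      (D :- i) :* ((K 1ℚ :+ i) :* g)
      := (K 1ℚ :+ (K 1ℚ :+ i)) :* ((D :- (K 1ℚ :+ i)) :* g)
         :+ K 1ℚ :* ((K (fromℕ 2) :* (K 1ℚ :+ i) :- D) :* g))
      refl D (fromℕ i) (g (suc i))

  -- The differential operators as letterwise actions

  coeff-sum : ∀ {n k} (F : Fin k → Polynomial n) m →
    coeff (MonoidSum.sum (LeftModule.+ᴹ-commutativeMonoid (ℚ[x] n)) F) m ≡ ∑ (λ i → coeff (F i) m)
  coeff-sum {k = zero}  F m = refl
  coeff-sum {k = suc k} F m = cong (coeff (F zero) m +_) (coeff-sum (F ∘ suc) m)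

  private
    -- The unfolded coefficient of `x· k (∂ k p)`, with an arbitrary function f in place of
    -- `coeff p` so that induction on the exponent vector can pass to `f ⟨ i ⟩`.
    coeff-x∂ : ∀ {n} → (Vec ℕ n → ℚ) → Vec ℕ n → Fin n → ℚ
    coeff-x∂ f m k = ifDivisible (lookup m k) (fromℕ (suc (lookup (lower k m) k)) * f (raise k (lower k m)))

    coeff-𝔢₊ : ∀ {n} → (Vec ℕ n → ℚ) → Vec ℕ n → Fin n → ℚ
    coeff-𝔢₊ f m k = - ifDivisible (lookup m k) (coeff-x∂ f (lower k m) k)
                     + D * ifDivisible (lookup m k) (f (lower k m))

    ∑-𝔢₋ : ∀ {n} (f : Vec ℕ n → ℚ) m →
           ∑ (λ k → fromℕ (suc (lookup m k)) * f (raise k m)) ≡ act 𝔢₋ f m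
    ∑-𝔢₋ f []      = refl
    ∑-𝔢₋ f (i ∷ w) = cong (fromℕ (suc i) * f (suc i ∷ w) +_) (∑-𝔢₋ (f ⟨ i ⟩) w)

    ∑-𝔢₊ : ∀ {n} (f : Vec ℕ n → ℚ) m → ∑ (coeff-𝔢₊ f m) ≡ act 𝔢₊ f m
    ∑-𝔢₊ f []      = refl
    ∑-𝔢₊ f (i ∷ w) = cong₂ _+_ (first i) (∑-𝔢₊ (f ⟨ i ⟩) w)
      where
      first : ∀ i → coeff-𝔢₊ f (i ∷ w) zero ≡ factor 𝔢₊ i * f (pred i ∷ w)
      -- The term with x² ∂ contributes from exponent 2 on, the term with d x already from exponent
      -- 1.
      first zero = solve 2 (λ D g → (:- K 0ℚ) :+ D :* K 0ℚ := K 0ℚ :* g) refl D (f (0 ∷ w))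
      first (suc zero) = solve 2 (λ D g → (:- K 0ℚ) :+ D :* g := (D :- K 0ℚ) :* g) refl D (f (0 ∷ w))
      first (suc (suc i)) = solve 3 (λ D i g → (:- (i :* g)) :+ D :* g := (D :- i) :* g)
        refl D (fromℕ (suc i)) (f (suc i ∷ w))

    -- The constant nd is distributed over the n letters, d to each, which makes `𝔥` a sum of
    -- one-letter operators.
    ∑-𝔥 : ∀ {n} (f : Vec ℕ n → ℚ) m →
          fromℕ 2 * ∑ (coeff-x∂ f m) + - (fromℕ (n ℕ.* d) * f m) ≡ act 𝔥 f m
    ∑-𝔥 f [] = solve 1 (λ g → K (fromℕ 2) :* K 0ℚ :+ (:- (K 0ℚ :* g)) := K 0ℚ) refl (f [])
    ∑-𝔥 {suc n} f (i ∷ w) = begin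
      fromℕ 2 * (coeff-x∂ f (i ∷ w) zero + S) + - (fromℕ (d ℕ.+ n ℕ.* d) * F)
        ≡⟨ cong₂ (λ t u → fromℕ 2 * (t + S) + - (u * F)) (first i) (fromℕ-+ d (n ℕ.* d)) ⟩
      fromℕ 2 * (fromℕ i * F + S) + - ((D + fromℕ (n ℕ.* d)) * F)
        ≡⟨ solve 5 (λ D N i S F → K (fromℕ 2) :* (i :* F :+ S) :+ (:- ((D :+ N) :* F))
             := (K (fromℕ 2) :* i :- D) :* F :+ (K (fromℕ 2) :* S :+ (:- (N :* F))))
             refl D (fromℕ (n ℕ.* d)) (fromℕ i) S F ⟩
      (fromℕ 2 * fromℕ i - D) * F + (fromℕ 2 * S + - (fromℕ (n ℕ.* d) * F))
        ≡⟨ cong ((fromℕ 2 * fromℕ i - D) * F +_) (∑-𝔥 (f ⟨ i ⟩) w) ⟩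
      act 𝔥 f (i ∷ w) ∎
      where
      open ≡-Reasoning
      F = f (i ∷ w)
      S = ∑ (coeff-x∂ (f ⟨ i ⟩) w)
      first : ∀ i → coeff-x∂ f (i ∷ w) zero ≡ fromℕ i * f (i ∷ w)
      first zero    = sym (ℚₚ.*-zeroˡ (f (0 ∷ w)))
      first (suc i) = refl

  coeff-diffOp : ∀ {n} x (p : Polynomial n) m → coeff (diffOp n d x p) m ≡ act x (coeff p) m
  coeff-diffOp {n} 𝔢₊ p m = trans
    (coeff-sum (λ k → -ᴹ x· k (x· k (∂ k p)) +ᴹ fromℕ d *ₗ x· k p) m)
    (∑-𝔢₊ (coeff p) m)
    where open LeftModule (ℚ[x] n)
  coeff-diffOp {n} 𝔥 p m = trans
    (cong (λ t → fromℕ 2 * t + - (fromℕ (n ℕ.* d) * coeff p m)) (coeff-sum (λ k → x· k (∂ k p)) m))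
    (∑-𝔥 (coeff p) m)
  coeff-diffOp 𝔢₋ p m = trans (coeff-sum (λ k → ∂ k p) m) (∑-𝔢₋ (coeff p) m)

  diffOp-isSl₂Action : ∀ n → IsSl₂Action (ℚ[x] n) (diffOp n d)
  diffOp-isSl₂Action n = record
    { linear = λ x → mkLinear (ℚ[x] n) (ℚ[x] n) (diffOp n d x)
        (λ {p} {q} e m → trans (coeff-diffOp x p m)
          (trans (act-cong x e m) (sym (coeff-diffOp x q m))))
        (λ p q m → trans (coeff-diffOp x _ m)
          (trans (act-+ x (coeff p) (coeff q) m)
            (cong₂ _+_ (sym (coeff-diffOp x p m)) (sym (coeff-diffOp x q m)))))
        (λ c p m → trans (coeff-diffOp x _ m)
          (trans (act-* x c (coeff p) m) (cong (c *_) (sym (coeff-diffOp x p m)))))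
    ; [𝔥,𝔢₊] = λ p → commutes⇒difference (ℚ[x] n)
        {ρ 𝔥 (ρ 𝔢₊ p)} {ρ 𝔢₊ (ρ 𝔥 p)} {fromℕ 2 *ₗ ρ 𝔢₊ p}
        (relation 𝔥 𝔢₊ 𝔢₊ (fromℕ 2) [𝔥,𝔢₊]₁ p)
    ; [𝔥,𝔢₋] = λ p → commutes⇒difference (ℚ[x] n)
        {ρ 𝔥 (ρ 𝔢₋ p)} {ρ 𝔢₋ (ρ 𝔥 p)} {(- fromℕ 2) *ₗ ρ 𝔢₋ p}
        (relation 𝔥 𝔢₋ 𝔢₋ (- fromℕ 2) [𝔥,𝔢₋]₁ p)
    ; [𝔢₊,𝔢₋] = λ p → commutes⇒difference (ℚ[x] n)
        {ρ 𝔢₊ (ρ 𝔢₋ p)} {ρ 𝔢₋ (ρ 𝔢₊ p)} {ρ 𝔥 p}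
        (λ m → trans (relation 𝔢₊ 𝔢₋ 𝔥 1ℚ [𝔢₊,𝔢₋]₁ p m)
          (cong (coeff (ρ 𝔢₋ (ρ 𝔢₊ p)) m +_) (ℚₚ.*-identityˡ (coeff (ρ 𝔥 p) m))))
    }
    where
    open LeftModule (ℚ[x] n) using (_*ₗ_)

    ρ : Basis-sl₂ → Polynomial n → Polynomial n
    ρ = diffOp n d

    diffOp² : ∀ x y p m → coeff (diffOp n d x (diffOp n d y p)) m ≡ act x (act y (coeff p)) m
    diffOp² x y p m = trans (coeff-diffOp x _ m) (act-cong x (coeff-diffOp y p) m)

    relation : ∀ x y z c →
      (∀ g i → act₁ x (act₁ y g) i ≡ act₁ y (act₁ x g) i + c * act₁ z g i) →
      ∀ p m → coeff (diffOp n d x (diffOp n d y p)) m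
            ≡ coeff (diffOp n d y (diffOp n d x p)) m + c * coeff (diffOp n d z p) m
    relation x y z c eq p m = trans (diffOp² x y p m) (trans (act-commutes x y z c eq (coeff p) m)
      (cong₂ _+_ (sym (diffOp² y x p m)) (cong (c *_) (sym (coeff-diffOp z p m)))))

-- The shuffle algebra

-- All word lengths occur at once because a term of `Sym` need not be homogeneous.
Series : Set
Series = ∀ n → Vec ℕ n → ℚ

infix 4 _≐_

_≐_ : Series → Series → Set
f ≐ g = ∀ n w → f n w ≡ g n w

δ₁ : ℕ → Series → Series
δ₁ i f n w = f (suc n) (i ∷ w)

δ₁-cong : ∀ {f g} i → f ≐ g → δ₁ i f ≐ δ₁ i g
δ₁-cong i e n w = e (suc n) (i ∷ w)

constant : ℚ → Series
constant c zero    w = c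
constant c (suc n) w = 0ℚ

constant-0 : constant 0ℚ ≐ (λ _ _ → 0ℚ)
constant-0 zero    w = refl
constant-0 (suc n) w = refl

letters : (ℕ → ℚ) → Series
letters a zero          w       = 0ℚ
letters a (suc zero)    (i ∷ w) = a i
letters a (suc (suc n)) w       = 0ℚ

δ₁-letters : ∀ a i → δ₁ i (letters a) ≐ constant (a i)
δ₁-letters a i zero    w = refl
δ₁-letters a i (suc n) w = refl

infixl 6 _+̇_
infixl 7 _ш_

_+̇_ : Series → Series → Series
(f +̇ g) n w = f n w + g n w

-- The value at w of a shuffle product sums f u * g u′ over all ways of splitting w into
-- complementary subwords u, u′.  Removing the first letter is thus a derivation.
_ш_ : Series → Series → Series
(f ш g) zero    w       = f 0 w * g 0 w
(f ш g) (suc n) (i ∷ w) = (δ₁ i f ш g) n w + (f ш δ₁ i g) n w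

ш-cong : ∀ {f f′ g g′} → f ≐ f′ → g ≐ g′ → f ш g ≐ f′ ш g′
ш-cong e e′ zero    w       = cong₂ _*_ (e 0 w) (e′ 0 w)
ш-cong e e′ (suc n) (i ∷ w) = cong₂ _+_ (ш-cong (δ₁-cong i e) e′ n w) (ш-cong e (δ₁-cong i e′) n w)

ш-congˡ : ∀ f {g g′} → g ≐ g′ → f ш g ≐ f ш g′
ш-congˡ f = ш-cong {f} (λ _ _ → refl)

ш-congʳ : ∀ g {f f′} → f ≐ f′ → f ш g ≐ f′ ш g
ш-congʳ g e = ш-cong {g = g} e (λ _ _ → refl)

ш-comm : ∀ f g → f ш g ≐ g ш f
ш-comm f g zero    w       = ℚₚ.*-comm (f 0 w) (g 0 w)
ш-comm f g (suc n) (i ∷ w) =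
  trans (cong₂ _+_ (ш-comm (δ₁ i f) g n w) (ш-comm f (δ₁ i g) n w))
        (ℚₚ.+-comm ((g ш δ₁ i f) n w) ((δ₁ i g ш f) n w))

ш-distribʳ : ∀ h f g → (f +̇ g) ш h ≐ f ш h +̇ g ш h
ш-distribʳ h f g zero    w       = ℚₚ.*-distribʳ-+ (h 0 w) (f 0 w) (g 0 w)
ш-distribʳ h f g (suc n) (i ∷ w) = trans
  (cong₂ _+_ (ш-distribʳ h (δ₁ i f) (δ₁ i g) n w) (ш-distribʳ (δ₁ i h) f g n w))
  (solve 4 (λ a b c d → (a :+ b) :+ (c :+ d) := (a :+ c) :+ (b :+ d)) refl
    ((δ₁ i f ш h) n w) ((δ₁ i g ш h) n w) ((f ш δ₁ i h) n w) ((g ш δ₁ i h) n w))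

ш-distribˡ : ∀ h f g → h ш (f +̇ g) ≐ h ш f +̇ h ш g
ш-distribˡ h f g n w = trans (ш-comm h (f +̇ g) n w) (trans (ш-distribʳ h f g n w)
  (cong₂ _+_ (ш-comm f h n w) (ш-comm g h n w)))

-- On either side, removing the first letter leaves three Leibniz terms, according to which of f, g
-- and h loses it; these match by induction.
ш-assoc : ∀ f g h → (f ш g) ш h ≐ f ш (g ш h)
ш-assoc f g h zero    w       = ℚₚ.*-assoc (f 0 w) (g 0 w) (h 0 w)
ш-assoc f g h (suc n) (i ∷ w) = begin
  ((δ₁ i f ш g +̇ f ш δ₁ i g) ш h) n w + ((f ш g) ш δ₁ i h) n w
    ≡⟨ cong₂ _+_ (ш-distribʳ h (δ₁ i f ш g) (f ш δ₁ i g) n w) (ш-assoc f g (δ₁ i h) n w) ⟩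
  (((δ₁ i f ш g) ш h) n w + ((f ш δ₁ i g) ш h) n w) + (f ш (g ш δ₁ i h)) n w
    ≡⟨ cong (_+ (f ш (g ш δ₁ i h)) n w)
         (cong₂ _+_ (ш-assoc (δ₁ i f) g h n w) (ш-assoc f (δ₁ i g) h n w)) ⟩
  ((δ₁ i f ш (g ш h)) n w + (f ш (δ₁ i g ш h)) n w) + (f ш (g ш δ₁ i h)) n w
    ≡⟨ ℚₚ.+-assoc ((δ₁ i f ш (g ш h)) n w) _ _ ⟩
  (δ₁ i f ш (g ш h)) n w + ((f ш (δ₁ i g ш h)) n w + (f ш (g ш δ₁ i h)) n w)
    ≡⟨ cong ((δ₁ i f ш (g ш h)) n w +_) (ш-distribˡ f (δ₁ i g ш h) (g ш δ₁ i h) n w) ⟨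
  (δ₁ i f ш (g ш h)) n w + (f ш (δ₁ i g ш h +̇ g ш δ₁ i h)) n w ∎
  where open ≡-Reasoning

ш-zeroˡ : ∀ {f} g → f ≐ (λ _ _ → 0ℚ) → f ш g ≐ (λ _ _ → 0ℚ)
ш-zeroˡ g e zero    w       = trans (cong (_* g 0 w) (e 0 w)) (ℚₚ.*-zeroˡ (g 0 w))
ш-zeroˡ g e (suc n) (i ∷ w) = cong₂ _+_ (ш-zeroˡ g (δ₁-cong i e) n w) (ш-zeroˡ (δ₁ i g) e n w)

ш-zeroʳ : ∀ f {g} → g ≐ (λ _ _ → 0ℚ) → f ш g ≐ (λ _ _ → 0ℚ)
ш-zeroʳ f {g} e n w = trans (ш-comm f g n w) (ш-zeroˡ f e n w)

constant-ш : ∀ c f → constant c ш f ≐ (λ n w → c * f n w)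
constant-ш c f zero    w       = refl
constant-ш c f (suc n) (i ∷ w) = trans
  (cong₂ _+_ (ш-zeroˡ f (λ _ _ → refl) n w) (constant-ш c (δ₁ i f) n w)) (ℚₚ.+-identityˡ _)

ш-scaleˡ : ∀ c f g → (λ n w → c * f n w) ш g ≐ (λ n w → c * (f ш g) n w)
ш-scaleˡ c f g n w = begin
  ((λ n w → c * f n w) ш g) n w  ≡⟨ ш-congʳ g (constant-ш c f) n w ⟨
  ((constant c ш f) ш g) n w     ≡⟨ ш-assoc (constant c) f g n w ⟩
  (constant c ш (f ш g)) n w     ≡⟨ constant-ш c (f ш g) n w ⟩
  c * (f ш g) n w                ∎
  where open ≡-Reasoning

ш-scaleʳ : ∀ c f g → f ш (λ n w → c * g n w) ≐ (λ n w → c * (f ш g) n w)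
ш-scaleʳ c f g n w = trans (ш-comm f _ n w) (trans (ш-scaleˡ c g f n w) (cong (c *_) (ш-comm g f n w)))

-- Removing two letters i, j gives four terms. The terms where both go to one factor are symmetric
-- by that factor's invariance; the two mixed terms trade places.
ш-swapInvariant : ∀ {f g} → (∀ n → SwapInvariant (f n)) → (∀ n → SwapInvariant (g n)) →
                  ∀ n → SwapInvariant ((f ш g) n)
ш-swapInvariant {f} {g} f-inv g-inv (suc (suc n)) (swap i j w) = begin
  (A i j + B i j) + (B j i + C i j)
    ≡⟨ cong₂ (λ a c → (a + B i j) + (B j i + c))
         (ш-congʳ g (λ n w → f-inv _ (swap i j w)) n w) (ш-congˡ f (λ n w → g-inv _ (swap i j w)) n w) ⟩
  (A j i + B i j) + (B j i + C j i)
    ≡⟨ solve 4 (λ a b b′ c → (a :+ b) :+ (b′ :+ c) := (a :+ b′) :+ (b :+ c)) refl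
         (A j i) (B i j) (B j i) (C j i) ⟩
  (A j i + B j i) + (B i j + C j i) ∎
  where
  open ≡-Reasoning
  A = λ i j → (δ₁ j (δ₁ i f) ш g) n w
  B = λ i j → (δ₁ i f ш δ₁ j g) n w
  C = λ i j → (f ш δ₁ j (δ₁ i g)) n w
ш-swapInvariant {f} {g} f-inv g-inv (suc n) (prep i r) = cong₂ _+_
  (ш-swapInvariant {δ₁ i f} {g} (λ m → ⟨⟩-swapInvariant (f-inv (suc m)) i) g-inv n r)
  (ш-swapInvariant {f} {δ₁ i g} f-inv (λ m → ⟨⟩-swapInvariant (g-inv (suc m)) i) n r)

ш-bounded : ∀ {d f g} → (∀ n → Bounded d (f n)) → (∀ n → Bounded d (g n)) → ∀ n → Bounded d ((f ш g) n)
ш-bounded {d} {f} {g} f-bd g-bd (suc n) (i ∷ w) zero d<i = cong₂ _+_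
  (ш-zeroˡ g (λ m u → f-bd (suc m) (i ∷ u) zero d<i) n w)
  (ш-zeroʳ f (λ m u → g-bd (suc m) (i ∷ u) zero d<i) n w)
ш-bounded {d} {f} {g} f-bd g-bd (suc n) (i ∷ w) (suc k) d<w = cong₂ _+_
  (ш-bounded {d} {δ₁ i f} {g} (λ m → ⟨⟩-bounded (f-bd (suc m)) i) g-bd n w k d<w)
  (ш-bounded {d} {f} {δ₁ i g} f-bd (λ m → ⟨⟩-bounded (g-bd (suc m)) i) n w k d<w)

-- Every letter of a word is handed to exactly one of the two factors, so an operator that changes
-- one letter at a time is a derivation. For the first letter this is the Leibniz rule of `δ₁ s`,
-- scaled by c; for the others it is induction.
act-ш : ∀ d x f g n w → act d x ((f ш g) n) w
  ≡ ((λ m → act d x (f m)) ш g) n w + (f ш (λ m → act d x (g m))) n w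
act-ш d x f g zero [] = sym (solve 2 (λ a b → K 0ℚ :* a :+ b :* K 0ℚ := K 0ℚ) refl (g 0 []) (f 0 []))
act-ш d x f g (suc n) (i ∷ w) = begin
  c * ((δ₁ s f ш g) n w + (f ш δ₁ s g) n w) + act d x ((δ₁ i f ш g +̇ f ш δ₁ i g) n) w
    ≡⟨ cong (c * (FS + GS) +_) (trans
         (act-+ d x ((δ₁ i f ш g) n) ((f ш δ₁ i g) n) w)
         (cong₂ _+_ (act-ш d x (δ₁ i f) g n w) (act-ш d x f (δ₁ i g) n w))) ⟩
  c * (FS + GS) + ((P + Q) + (R + S))
    ≡⟨ solve 7 (λ c a b p q r s →
         c :* (a :+ b) :+ ((p :+ q) :+ (r :+ s))
         := ((c :* a :+ p) :+ r) :+ (q :+ (c :* b :+ s))) refl c FS GS P Q R S ⟩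
  ((c * FS + P) + R) + (Q + (c * GS + S))
    ≡⟨ cong₂ (λ a b → ((a + P) + R) + (Q + (b + S)))
         (ш-scaleˡ c (δ₁ s f) g n w) (ш-scaleʳ c f (δ₁ s g) n w) ⟨
  ((((λ n w → c * δ₁ s f n w) ш g) n w + P) + R) + (Q + ((f ш (λ n w → c * δ₁ s g n w)) n w + S))
    ≡⟨ cong₂ (λ a b → (a + R) + (Q + b))
         (ш-distribʳ g (λ n w → c * δ₁ s f n w) (λ m → act d x (δ₁ i f m)) n w)
         (ш-distribˡ f (λ n w → c * δ₁ s g n w) (λ m → act d x (δ₁ i g m)) n w) ⟨
  ((δ₁ i (λ m → act d x (f m)) ш g) n w + R) + (Q + (f ш δ₁ i (λ m → act d x (g m))) n w) ∎
  where
  open ≡-Reasoning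
  s = shift d x i
  c = factor d x i
  FS = (δ₁ s f ш g) n w
  GS = (f ш δ₁ s g) n w
  P = ((λ m → act d x (δ₁ i f m)) ш g) n w
  Q = (δ₁ i f ш (λ m → act d x (g m))) n w
  R = ((λ m → act d x (f m)) ш δ₁ i g) n w
  S = (f ш (λ m → act d x (δ₁ i g m))) n w

-- Coordinates on V_d

extend : ∀ {k} → (Fin k → ℚ) → ℕ → ℚ
extend {zero}  a i       = 0ℚ
extend {suc k} a zero    = a zero
extend {suc k} a (suc i) = extend (a ∘ suc) i

extend-cong : ∀ {k} {a b : Fin k → ℚ} → (∀ i → a i ≡ b i) → ∀ i → extend a i ≡ extend b i
extend-cong {zero}  e i       = refl
extend-cong {suc k} e zero    = e zero
extend-cong {suc k} e (suc i) = extend-cong (e ∘ suc) i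

extend-+ : ∀ {k} (a b : Fin k → ℚ) i → extend (λ j → a j + b j) i ≡ extend a i + extend b i
extend-+ {zero}  a b i       = refl
extend-+ {suc k} a b zero    = refl
extend-+ {suc k} a b (suc i) = extend-+ (a ∘ suc) (b ∘ suc) i

extend-* : ∀ {k} c (a : Fin k → ℚ) i → extend (λ j → c * a j) i ≡ c * extend a i
extend-* {zero}  c a i       = sym (ℚₚ.*-zeroʳ c)
extend-* {suc k} c a zero    = refl
extend-* {suc k} c a (suc i) = extend-* c (a ∘ suc) i

extend-toℕ : ∀ {k} (a : Fin k → ℚ) i → extend a (toℕ i) ≡ a i
extend-toℕ a zero    = refl
extend-toℕ a (suc i) = extend-toℕ (a ∘ suc) i

extend-unique : ∀ {k} {a : Fin k → ℚ} {g : ℕ → ℚ} → (∀ i → a i ≡ g (toℕ i)) → (∀ i → k ≤ i → g i ≡ 0ℚ) →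
                ∀ i → extend a i ≡ g i
extend-unique {zero}  e g-bd i       = sym (g-bd i z≤n)
extend-unique {suc k} e g-bd zero    = e zero
extend-unique {suc k} e g-bd (suc i) = extend-unique (e ∘ suc) (λ j k≤j → g-bd (suc j) (s≤s k≤j)) i

extend-bounded : ∀ {k} (a : Fin k → ℚ) i → k ≤ i → extend a i ≡ 0ℚ
extend-bounded {zero}  a i       _         = refl
extend-bounded {suc k} a (suc i) (s≤s k≤i) = extend-bounded (a ∘ suc) i k≤i

-- The summands have the shape of `ρ-on-basis`, h being the scalar in front of the basis vector. For
-- j beyond the last index both sides vanish; `𝔢₋` reaches that index in `extend-V-ρ`.
∑-δ : ∀ {k} (a : Fin k → ℚ) (h : ℕ → ℚ) j →
      ∑ (λ i → a i * (h (toℕ i) * δ (toℕ i) j)) ≡ h j * extend a j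
∑-δ {zero}  a h j       = sym (ℚₚ.*-zeroʳ (h j))
∑-δ {suc k} a h zero    = trans
  (cong (a zero * (h 0 * 1ℚ) +_) (trans
    (∑-cong (λ i → trans (cong (a (suc i) *_) (ℚₚ.*-zeroʳ (h (suc (toℕ i))))) (ℚₚ.*-zeroʳ (a (suc i)))))
    (∑-zero k)))
  (solve 2 (λ a h → a :* (h :* K 1ℚ) :+ K 0ℚ := h :* a) refl (a zero) (h 0))
∑-δ {suc k} a h (suc j) = trans
  (cong (a zero * (h 0 * 0ℚ) +_) (∑-δ (a ∘ suc) (h ∘ suc) j))
  (solve 3 (λ a h r → a :* (h :* K 0ℚ) :+ r := r) refl (a zero) (h 0) (h (suc j) * extend (a ∘ suc) j))

linearCombination-ℚ^ : ∀ {k l} (c : Fin k → ℚ) (b : Fin k → Fin l → ℚ) j →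
  linearCombination (ℚ^ l) c b j ≡ ∑ (λ i → c i * b i j)
linearCombination-ℚ^ {zero}  c b j = refl
linearCombination-ℚ^ {suc k} c b j = cong (c zero * b zero j +_) (linearCombination-ℚ^ (c ∘ suc) (b ∘ suc) j)

v-spanning : ∀ d (a : Fin (suc d) → ℚ) j → a j ≡ linearCombination (ℚ^ (suc d)) a (λ i → v d (toℕ i)) j
v-spanning d a j = sym (begin
  linearCombination (ℚ^ (suc d)) a (λ i → v d (toℕ i)) j  ≡⟨ linearCombination-ℚ^ a (λ i → v d (toℕ i)) j ⟩
  ∑ (λ i → a i * δ (toℕ i) (toℕ j))
    ≡⟨ ∑-cong (λ i → cong (a i *_) (ℚₚ.*-identityˡ (δ (toℕ i) (toℕ j)))) ⟨
  ∑ (λ i → a i * (1ℚ * δ (toℕ i) (toℕ j)))                ≡⟨ ∑-δ a (λ _ → 1ℚ) (toℕ j) ⟩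
  1ℚ * extend a (toℕ j)                                   ≡⟨ ℚₚ.*-identityˡ _ ⟩
  extend a (toℕ j)                                        ≡⟨ extend-toℕ a j ⟩
  a j                                                     ∎)
  where open ≡-Reasoning

-- V_d is the one-variable case, with v_i read as t^i. The two sides are compared up to index d as
-- matrix entries; beyond d both vanish, the right one by `act₁-bounded`.
extend-V-ρ : ∀ d x a j → extend (V-ρ d x a) j ≡ act₁ d x (extend a) j
extend-V-ρ d x a = extend-unique
  (λ j → trans (linearCombination-ℚ^ a (λ i → ρ-on-basis d x (toℕ i)) j) (column x j))
  (act₁-bounded d x (extend-bounded a))
  where
  column : ∀ x (j : Fin (suc d)) → ∑ (λ i → a i * ρ-on-basis d x (toℕ i) j) ≡ act₁ d x (extend a) (toℕ j)
  column 𝔢₊ zero = trans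
    (∑-cong (λ i → trans (cong (a i *_) (ℚₚ.*-zeroʳ (fromℕ d - fromℕ (toℕ i)))) (ℚₚ.*-zeroʳ (a i))))
    (trans (∑-zero (suc d)) (sym (ℚₚ.*-zeroˡ (a zero))))
  column 𝔢₊ (suc j) = ∑-δ a (λ i → fromℕ d - fromℕ i) (toℕ j)
  column 𝔥 j = ∑-δ a (λ i → fromℕ 2 * fromℕ i - fromℕ d) (toℕ j)
  column 𝔢₋ j = trans (∑-cong (λ i → cong (a i *_) (lowered (toℕ i)))) (∑-δ a fromℕ (suc (toℕ j)))
    where
    lowered : ∀ i → fromℕ i * δ (pred i) (toℕ j) ≡ fromℕ i * δ i (suc (toℕ j))
    lowered zero    = ℚₚ.*-zeroˡ (δ 0 (toℕ j))
    lowered (suc i) = refl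

-- Polarization

fromℕ-nonZero : ∀ n → NonZero (fromℕ (suc n))
fromℕ-nonZero n = ℚₚ.pos⇒nonZero (fromℕ (suc n)) {{ℚₚ.normalize-pos (suc n) 1}}

factorial : ℕ → ℚ
factorial zero    = 1ℚ
factorial (suc n) = fromℕ (suc n) * factorial n

1/factorial : ℕ → ℚ
1/factorial zero    = 1ℚ
1/factorial (suc n) = 1/factorial n * (1/ fromℕ (suc n)) {{fromℕ-nonZero n}}

1/factorial-inverse : ∀ n → 1/factorial n * factorial n ≡ 1ℚ
1/factorial-inverse zero    = refl
1/factorial-inverse (suc n) = begin
  (1/factorial n * r) * (N * factorial n)
    ≡⟨ solve 4 (λ a r N f → (a :* r) :* (N :* f) := (a :* f) :* (r :* N))
         refl (1/factorial n) r N (factorial n) ⟩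
  (1/factorial n * factorial n) * (r * N)
    ≡⟨ cong₂ _*_ (1/factorial-inverse n) (ℚₚ.*-inverseˡ N {{fromℕ-nonZero n}}) ⟩
  1ℚ * 1ℚ ∎
  where
  open ≡-Reasoning
  N = fromℕ (suc n)
  r = (1/ N) {{fromℕ-nonZero n}}

1/factorial-cancel : ∀ n q → 1/factorial n * (factorial n * q) ≡ q
1/factorial-cancel n q = trans (sym (ℚₚ.*-assoc (1/factorial n) (factorial n) q))
  (trans (cong (_* q) (1/factorial-inverse n)) (ℚₚ.*-identityˡ q))

module Polarization (d : ℕ) where
  open SymmetricAlgebra (ℚ^ (suc d))
  open CommutativeSemiring commutativeSemiring using (semiring)
  open SemiringSum semiring
    using (sum; sum-cong-≋; sum-replicate-zero; ∑-distrib-+; *-distribˡ-sum; *-distribʳ-sum)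
  open LinearCombination space using (*ₗ-sum)
  private
    module Solver = SemiringSolver commutativeSemiring
    module ∼-Reasoning = SetoidReasoning ∼-setoid

  ⟦_⟧ : Sym → Series
  ⟦ con c ⟧ = constant c
  ⟦ ι a ⟧   = letters (extend a)
  ⟦ x ⊕ y ⟧ = ⟦ x ⟧ +̇ ⟦ y ⟧
  ⟦ x ⊗ y ⟧ = ⟦ x ⟧ ш ⟦ y ⟧

  ⟦⟧-cong : ∀ {x y} → x ∼ y → ⟦ x ⟧ ≐ ⟦ y ⟧
  ⟦⟧-cong ∼-refl n w = refl
  ⟦⟧-cong (∼-sym e) n w = sym (⟦⟧-cong e n w)
  ⟦⟧-cong (∼-trans e e′) n w = trans (⟦⟧-cong e n w) (⟦⟧-cong e′ n w)
  ⟦⟧-cong (⊕-cong e e′) n w = cong₂ _+_ (⟦⟧-cong e n w) (⟦⟧-cong e′ n w)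
  ⟦⟧-cong (⊗-cong e e′) n w = ш-cong (⟦⟧-cong e) (⟦⟧-cong e′) n w
  ⟦⟧-cong (ι-cong e) zero w = refl
  ⟦⟧-cong (ι-cong e) (suc zero) (i ∷ w) = extend-cong e i
  ⟦⟧-cong (ι-cong e) (suc (suc n)) w = refl
  ⟦⟧-cong (⊕-assoc x y z) n w = ℚₚ.+-assoc (⟦ x ⟧ n w) (⟦ y ⟧ n w) (⟦ z ⟧ n w)
  ⟦⟧-cong (⊕-comm x y) n w = ℚₚ.+-comm (⟦ x ⟧ n w) (⟦ y ⟧ n w)
  ⟦⟧-cong (⊕-identityˡ x) n w = trans (cong (_+ ⟦ x ⟧ n w) (constant-0 n w)) (ℚₚ.+-identityˡ (⟦ x ⟧ n w))
  ⟦⟧-cong (⊗-assoc x y z) n w = ш-assoc ⟦ x ⟧ ⟦ y ⟧ ⟦ z ⟧ n w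
  ⟦⟧-cong (⊗-comm x y) n w = ш-comm ⟦ x ⟧ ⟦ y ⟧ n w
  ⟦⟧-cong (⊗-identityˡ x) n w = trans (constant-ш 1ℚ ⟦ x ⟧ n w) (ℚₚ.*-identityˡ (⟦ x ⟧ n w))
  ⟦⟧-cong (⊗-zeroˡ x) n w = trans (ш-zeroˡ ⟦ x ⟧ constant-0 n w) (sym (constant-0 n w))
  ⟦⟧-cong (⊗-distribʳ x y z) n w = ш-distribʳ ⟦ x ⟧ ⟦ y ⟧ ⟦ z ⟧ n w
  ⟦⟧-cong (con-+ a b) zero w = refl
  ⟦⟧-cong (con-+ a b) (suc n) w = refl
  ⟦⟧-cong (con-* a b) n w = sym (trans (constant-ш a (constant b) n w) (scaled n w))
    where
    scaled : ∀ n w → a * constant b n w ≡ constant (a * b) n w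
    scaled zero    w = refl
    scaled (suc n) w = ℚₚ.*-zeroʳ a
  ⟦⟧-cong (ι-+ a b) zero w = refl
  ⟦⟧-cong (ι-+ a b) (suc zero) (i ∷ w) = extend-+ a b i
  ⟦⟧-cong (ι-+ a b) (suc (suc n)) w = refl
  ⟦⟧-cong (ι-*ₗ c a) n w = sym (trans (constant-ш c (letters (extend a)) n w) (scaled n w))
    where
    scaled : ∀ n w → c * letters (extend a) n w ≡ letters (extend (λ j → c * a j)) n w
    scaled zero          w       = ℚₚ.*-zeroʳ c
    scaled (suc zero)    (i ∷ w) = sym (extend-* c a i)
    scaled (suc (suc n)) w       = ℚₚ.*-zeroʳ c

  ⟦⟧-scale : ∀ c x n w → ⟦ con c ⊗ x ⟧ n w ≡ c * ⟦ x ⟧ n w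
  ⟦⟧-scale c x = constant-ш c ⟦ x ⟧

  ⟦⟧-sum : ∀ {k} (F : Fin k → Sym) n w → ⟦ sum F ⟧ n w ≡ ∑ (λ i → ⟦ F i ⟧ n w)
  ⟦⟧-sum {zero}  F n w = constant-0 n w
  ⟦⟧-sum {suc k} F n w = cong (⟦ F zero ⟧ n w +_) (⟦⟧-sum (F ∘ suc) n w)

  ⟦⟧-swapInvariant : ∀ x n → SwapInvariant (⟦ x ⟧ n)
  ⟦⟧-swapInvariant (con c) (suc n) r = refl
  ⟦⟧-swapInvariant (ι a) (suc (suc n)) r = refl
  ⟦⟧-swapInvariant (ι a) (suc zero) (prep i ())
  ⟦⟧-swapInvariant (x ⊕ y) n r = cong₂ _+_ (⟦⟧-swapInvariant x n r) (⟦⟧-swapInvariant y n r)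
  ⟦⟧-swapInvariant (x ⊗ y) = ш-swapInvariant (⟦⟧-swapInvariant x) (⟦⟧-swapInvariant y)

  ⟦⟧-bounded : ∀ x n → Bounded d (⟦ x ⟧ n)
  ⟦⟧-bounded (con c) (suc n) w k d<w = refl
  ⟦⟧-bounded (ι a) (suc zero) (i ∷ []) zero d<i = extend-bounded a i d<i
  ⟦⟧-bounded (ι a) (suc (suc n)) w k d<w = refl
  ⟦⟧-bounded (x ⊕ y) n w k d<w = cong₂ _+_ (⟦⟧-bounded x n w k d<w) (⟦⟧-bounded y n w k d<w)
  ⟦⟧-bounded (x ⊗ y) = ш-bounded (⟦⟧-bounded x) (⟦⟧-bounded y)

  -- Both sides are derivations in y, the right one by `act-ш`, so they need only agree on constants
  -- and on the generators `ι a`; the latter is `extend-V-ρ`.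
  ⟦⟧-derivation : ∀ x y n w → ⟦ derivation (V-ρ d x) y ⟧ n w ≡ act d x (⟦ y ⟧ n) w
  ⟦⟧-derivation x (con c) zero [] = refl
  ⟦⟧-derivation x (con c) (suc n) w = sym (act-zero d x (λ _ → refl) w)
  ⟦⟧-derivation x (ι a) zero [] = refl
  ⟦⟧-derivation x (ι a) (suc zero) (i ∷ []) = trans (extend-V-ρ d x a i) (sym (ℚₚ.+-identityʳ _))
  ⟦⟧-derivation x (ι a) (suc (suc n)) w = sym (act-zero d x (λ _ → refl) w)
  ⟦⟧-derivation x (y ⊕ z) n w = trans
    (cong₂ _+_ (⟦⟧-derivation x y n w) (⟦⟧-derivation x z n w)) (sym (act-+ d x (⟦ y ⟧ n) (⟦ z ⟧ n) w))
  ⟦⟧-derivation x (y ⊗ z) n w = trans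
    (cong₂ _+_ (ш-congʳ ⟦ z ⟧ (⟦⟧-derivation x y) n w) (ш-congˡ ⟦ y ⟧ (⟦⟧-derivation x z) n w))
    (sym (act-ш d x ⟦ y ⟧ ⟦ z ⟧ n w))

  e : Fin (suc d) → Sym
  e i = ι (v d (toℕ i))

  T : ∀ n → (Vec ℕ n → ℚ) → Sym
  T zero    f = con (f [])
  T (suc n) f = sum (λ i → e i ⊗ T n (f ⟨ toℕ i ⟩))

  ≡⇒∼ : ∀ {x y} → x ≡ y → x ∼ y
  ≡⇒∼ refl = ∼-refl

  T-cong : ∀ n {f g : Vec ℕ n → ℚ} → (∀ w → f w ≡ g w) → T n f ∼ T n g
  T-cong zero    eq = ≡⇒∼ (cong con (eq []))
  T-cong (suc n) eq = sum-cong-≋ {suc d} (λ i → ⊗-congˡ {e i} (T-cong n (λ w → eq (toℕ i ∷ w))))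

  T-+ : ∀ n (f g : Vec ℕ n → ℚ) → T n (λ w → f w + g w) ∼ T n f ⊕ T n g
  T-+ zero    f g = con-+ (f []) (g [])
  T-+ (suc n) f g = ∼-trans
    (sum-cong-≋ (λ i → ∼-trans (⊗-congˡ (T-+ n (f ⟨ toℕ i ⟩) (g ⟨ toℕ i ⟩))) (⊗-distribˡ (e i) _ _)))
    (∑-distrib-+ (λ i → e i ⊗ T n (f ⟨ toℕ i ⟩)) (λ i → e i ⊗ T n (g ⟨ toℕ i ⟩)))

  T-* : ∀ n c (f : Vec ℕ n → ℚ) → T n (λ w → c * f w) ∼ con c ⊗ T n f
  T-* zero    c f = con-* c (f [])
  T-* (suc n) c f = ∼-trans
    (sum-cong-≋ (λ i → ∼-trans (⊗-congˡ (T-* n c (f ⟨ toℕ i ⟩)))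
      (Solver.solve 3 (λ x c y → x Solver.:* (c Solver.:* y) Solver.:= c Solver.:* (x Solver.:* y))
        ∼-refl (e i) (con c) (T n (f ⟨ toℕ i ⟩)))))
    (∼-sym (*ₗ-sum c (λ i → e i ⊗ T n (f ⟨ toℕ i ⟩))))

  T-zero : ∀ n {f : Vec ℕ n → ℚ} → (∀ w → f w ≡ 0ℚ) → T n f ∼ con 0ℚ
  T-zero n {f} eq = ∼-trans (T-cong n (λ w → trans (eq w) (sym (ℚₚ.*-zeroˡ (f w)))))
    (∼-trans (T-* n 0ℚ f) (⊗-zeroˡ _))

  ι-⊗-HasDegree : ∀ {n} a {x} → HasDegree n x → HasDegree (suc n) (ι a ⊗ x)
  ι-⊗-HasDegree a (product vs) = product (a ∷ vs)
  ι-⊗-HasDegree a zero = resp (∼-sym (⊗-zeroʳ _)) zero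
  ι-⊗-HasDegree a (add p q) = resp (∼-sym (⊗-distribˡ _ _ _)) (add (ι-⊗-HasDegree a p) (ι-⊗-HasDegree a q))
  ι-⊗-HasDegree a (scale c {x} p) = resp
    (Solver.solve 3 (λ c y x → c Solver.:* (y Solver.:* x) Solver.:= y Solver.:* (c Solver.:* x))
      ∼-refl (con c) (ι a) x)
    (scale c (ι-⊗-HasDegree a p))
  ι-⊗-HasDegree a (resp eq p) = resp (⊗-congˡ eq) (ι-⊗-HasDegree a p)

  sum-HasDegree : ∀ {n k} (F : Fin k → Sym) → (∀ i → HasDegree n (F i)) → HasDegree n (sum F)
  sum-HasDegree {k = zero}  F F-deg = zero
  sum-HasDegree {k = suc k} F F-deg = add (F-deg zero) (sum-HasDegree (F ∘ suc) (F-deg ∘ suc))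

  T-HasDegree : ∀ n f → HasDegree n (T n f)
  T-HasDegree zero    f = resp (∼-trans (⊗-comm _ _) (⊗-identityˡ (con (f [])))) (scale (f []) (product []))
  T-HasDegree (suc n) f = sum-HasDegree (λ i → e i ⊗ T n (f ⟨ toℕ i ⟩))
    (λ i → ι-⊗-HasDegree (v d (toℕ i)) (T-HasDegree n (f ⟨ toℕ i ⟩)))

  ι-spanning : ∀ a → sum (λ i → con (a i) ⊗ e i) ∼ ι a
  ι-spanning a = ∼-trans
    (∼-sym (linear-lc (ℚ^ (suc d)) space ι-linear a (λ i → v d (toℕ i))))
    (ι-cong (λ j → sym (v-spanning d a j)))
    where
    ι-linear : IsLinear (ℚ^ (suc d)) space ι
    ι-linear = mkLinear (ℚ^ (suc d)) space ι ι-cong ι-+ ι-*ₗ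

  -- Euler's identity at work: the first letter i comes from a or from g. The first case contributes
  -- one copy of `ι a ⊗ T n (g n)`, since the a_i e_i add up to `ι a`. The second contributes n
  -- copies, by induction applied to `δ₁ (toℕ i) g`.
  T-letters-ш : ∀ n a g →
    T (suc n) ((letters (extend a) ш g) (suc n)) ∼ con (fromℕ (suc n)) ⊗ (ι a ⊗ T n (g n))
  T-letters-ш n a g = begin
    sum (λ i → e i ⊗ T n (λ w → (δ₁ (toℕ i) A ш g) n w + (A ш δ₁ (toℕ i) g) n w))
      ≈⟨ sum-cong-≋ (λ i → ∼-trans (⊗-congˡ (step i)) (regroup i)) ⟩
    sum (λ i → (con (a i) ⊗ e i) ⊗ T n (g n) ⊕ e i ⊗ T n ((A ш δ₁ (toℕ i) g) n))
      ≈⟨ ∑-distrib-+ (λ i → (con (a i) ⊗ e i) ⊗ T n (g n)) (λ i → e i ⊗ T n ((A ш δ₁ (toℕ i) g) n)) ⟩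
    sum (λ i → (con (a i) ⊗ e i) ⊗ T n (g n)) ⊕ sum (λ i → e i ⊗ T n ((A ш δ₁ (toℕ i) g) n))
      ≈⟨ ⊕-cong (∼-sym (*-distribʳ-sum (T n (g n)) (λ i → con (a i) ⊗ e i))) (rest n g) ⟩
    sum (λ i → con (a i) ⊗ e i) ⊗ T n (g n) ⊕ con (fromℕ n) ⊗ (ι a ⊗ T n (g n))
      ≈⟨ ⊕-congʳ (∼-trans (⊗-congʳ (ι-spanning a)) (∼-sym (⊗-identityˡ _))) ⟩
    con 1ℚ ⊗ (ι a ⊗ T n (g n)) ⊕ con (fromℕ n) ⊗ (ι a ⊗ T n (g n))
      ≈⟨ ⊗-distribʳ _ _ _ ⟨
    (con 1ℚ ⊕ con (fromℕ n)) ⊗ (ι a ⊗ T n (g n))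
      ≈⟨ ⊗-congʳ (∼-trans (≡⇒∼ (cong con (fromℕ-suc n))) (con-+ 1ℚ (fromℕ n))) ⟨
    con (fromℕ (suc n)) ⊗ (ι a ⊗ T n (g n)) ∎
    where
    open ∼-Reasoning
    A = letters (extend a)

    step : ∀ i → T n (λ w → (δ₁ (toℕ i) A ш g) n w + (A ш δ₁ (toℕ i) g) n w)
               ∼ con (a i) ⊗ T n (g n) ⊕ T n ((A ш δ₁ (toℕ i) g) n)
    step i = ∼-trans (T-+ n ((δ₁ (toℕ i) A ш g) n) ((A ш δ₁ (toℕ i) g) n))
      (⊕-congʳ (∼-trans (T-cong n (λ w → trans
          (ш-congʳ g (δ₁-letters (extend a) (toℕ i)) n w)
          (trans (constant-ш (extend a (toℕ i)) g n w) (cong (_* g n w) (extend-toℕ a i)))))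
        (T-* n (a i) (g n))))

    regroup : ∀ i → e i ⊗ (con (a i) ⊗ T n (g n) ⊕ T n ((A ш δ₁ (toℕ i) g) n))
                  ∼ (con (a i) ⊗ e i) ⊗ T n (g n) ⊕ e i ⊗ T n ((A ш δ₁ (toℕ i) g) n)
    regroup i = Solver.solve 4 (λ x c y z →
      x Solver.:* (c Solver.:* y Solver.:+ z) Solver.:= (c Solver.:* x) Solver.:* y Solver.:+ x Solver.:* z)
      ∼-refl (e i) (con (a i)) (T n (g n)) (T n ((A ш δ₁ (toℕ i) g) n))

    rest : ∀ n g → sum (λ i → e i ⊗ T n ((A ш δ₁ (toℕ i) g) n)) ∼ con (fromℕ n) ⊗ (ι a ⊗ T n (g n))
    rest zero g = ∼-trans
      (sum-cong-≋ (λ i → ∼-trans (⊗-congˡ (≡⇒∼ (cong con (ℚₚ.*-zeroˡ (δ₁ (toℕ i) g 0 []))))) (⊗-zeroʳ (e i))))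
      (∼-trans (sum-replicate-zero (suc d)) (∼-sym (⊗-zeroˡ _)))
    rest (suc n) g = begin
      sum (λ i → e i ⊗ T (suc n) ((A ш δ₁ (toℕ i) g) (suc n)))
        ≈⟨ sum-cong-≋ (λ i → ∼-trans (⊗-congˡ (T-letters-ш n a (δ₁ (toℕ i) g)))
             (Solver.solve 4 (λ x c y z → x Solver.:* (c Solver.:* (y Solver.:* z))
                                Solver.:= (c Solver.:* y) Solver.:* (x Solver.:* z))
                ∼-refl (e i) (con (fromℕ (suc n))) (ι a) (T n (δ₁ (toℕ i) g n)))) ⟩
      sum (λ i → (con (fromℕ (suc n)) ⊗ ι a) ⊗ (e i ⊗ T n (δ₁ (toℕ i) g n)))
        ≈⟨ *-distribˡ-sum (con (fromℕ (suc n)) ⊗ ι a) (λ i → e i ⊗ T n (δ₁ (toℕ i) g n)) ⟨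
      (con (fromℕ (suc n)) ⊗ ι a) ⊗ T (suc n) (g (suc n))
        ≈⟨ ⊗-assoc _ _ _ ⟩
      con (fromℕ (suc n)) ⊗ (ι a ⊗ T (suc n) (g (suc n))) ∎

  -- Both sides respect sums, scalars and `∼`, so products of vectors decide. There each additional
  -- factor brings in `fromℕ (suc n)` through `T-letters-ш`, whence the factorial.
  T-⟦⟧ : ∀ {n x} → HasDegree n x → T n (⟦ x ⟧ n) ∼ con (factorial n) ⊗ x
  T-⟦⟧ (product []) = ∼-sym (⊗-identityˡ _)
  T-⟦⟧ {suc n} (product (a ∷ vs)) = begin
    T (suc n) ((letters (extend a) ш ⟦ ∏ι vs ⟧) (suc n))
      ≈⟨ T-letters-ш n a ⟦ ∏ι vs ⟧ ⟩
    con (fromℕ (suc n)) ⊗ (ι a ⊗ T n (⟦ ∏ι vs ⟧ n))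
      ≈⟨ ⊗-congˡ (⊗-congˡ (T-⟦⟧ (product vs))) ⟩
    con (fromℕ (suc n)) ⊗ (ι a ⊗ (con (factorial n) ⊗ ∏ι vs))
      ≈⟨ Solver.solve 4 (λ c y f z → c Solver.:* (y Solver.:* (f Solver.:* z))
                           Solver.:= (c Solver.:* f) Solver.:* (y Solver.:* z))
           ∼-refl (con (fromℕ (suc n))) (ι a) (con (factorial n)) (∏ι vs) ⟩
    (con (fromℕ (suc n)) ⊗ con (factorial n)) ⊗ (ι a ⊗ ∏ι vs)
      ≈⟨ ⊗-congʳ (con-* (fromℕ (suc n)) (factorial n)) ⟨
    con (factorial (suc n)) ⊗ (ι a ⊗ ∏ι vs) ∎
    where open ∼-Reasoning
  T-⟦⟧ {n} zero = ∼-trans (T-zero n (constant-0 n)) (∼-sym (⊗-zeroʳ _))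
  T-⟦⟧ {n} (add {x} {y} p q) = ∼-trans (T-+ n (⟦ x ⟧ n) (⟦ y ⟧ n))
    (∼-trans (⊕-cong (T-⟦⟧ p) (T-⟦⟧ q)) (∼-sym (⊗-distribˡ _ x y)))
  T-⟦⟧ {n} (scale c {x} p) = ∼-trans (T-cong n (⟦⟧-scale c x n))
    (∼-trans (T-* n c (⟦ x ⟧ n)) (∼-trans (⊗-congˡ (T-⟦⟧ p))
      (Solver.solve 3 (λ c f x → c Solver.:* (f Solver.:* x) Solver.:= f Solver.:* (c Solver.:* x))
        ∼-refl (con c) (con (factorial n)) x)))
  T-⟦⟧ {n} (resp eq p) = ∼-trans (T-cong n (λ w → sym (⟦⟧-cong eq n w))) (∼-trans (T-⟦⟧ p) (⊗-congˡ eq))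

  -- The derivation `δ₁ j` hits either `e i`, which selects i = j and gives one copy of the result,
  -- or `T n (f ⟨ toℕ i ⟩)`. In the latter case induction produces `f ⟨ toℕ i ⟩ ⟨ j ⟩`, symmetry
  -- exchanges the two letters, and the sum reassembles to n copies. The word length m is arbitrary
  -- because the induction takes place inside a shuffle product.
  δ₁-⟦T⟧ : ∀ n {f : Vec ℕ (suc n) → ℚ} → SwapInvariant f → Bounded d f → ∀ j m w →
           ⟦ T (suc n) f ⟧ (suc m) (j ∷ w) ≡ fromℕ (suc n) * ⟦ T n (f ⟨ j ⟩) ⟧ m w
  δ₁-⟦T⟧ n {f} f-inv f-bd j m w = begin
    ⟦ sum (λ i → e i ⊗ T n (f ⟨ toℕ i ⟩)) ⟧ (suc m) (j ∷ w)
      ≡⟨ ⟦⟧-sum {suc d} (λ i → e i ⊗ T n (f ⟨ toℕ i ⟩)) (suc m) (j ∷ w) ⟩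
    ∑ (λ i → (δ₁ j ⟦ e i ⟧ ш ⟦ T n (f ⟨ toℕ i ⟩) ⟧) m w + (⟦ e i ⟧ ш δ₁ j ⟦ T n (f ⟨ toℕ i ⟩) ⟧) m w)
      ≡⟨ ∑-+
           (λ i → (δ₁ j ⟦ e i ⟧ ш ⟦ T n (f ⟨ toℕ i ⟩) ⟧) m w)
           (λ i → (⟦ e i ⟧ ш δ₁ j ⟦ T n (f ⟨ toℕ i ⟩) ⟧) m w) ⟩
    ∑ (λ i → (δ₁ j ⟦ e i ⟧ ш ⟦ T n (f ⟨ toℕ i ⟩) ⟧) m w)
      + ∑ (λ i → (⟦ e i ⟧ ш δ₁ j ⟦ T n (f ⟨ toℕ i ⟩) ⟧) m w)
      ≡⟨ cong₂ _+_ first (rest n f-inv f-bd) ⟩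
    R + fromℕ n * R
      ≡⟨ solve 2 (λ N r → r :+ N :* r := (K 1ℚ :+ N) :* r) refl (fromℕ n) R ⟩
    (1ℚ + fromℕ n) * R
      ≡⟨ cong (_* R) (fromℕ-suc n) ⟨
    fromℕ (suc n) * R ∎
    where
    open ≡-Reasoning
    R = ⟦ T n (f ⟨ j ⟩) ⟧ m w

    G : ℕ → ℚ
    G i = ⟦ T n (f ⟨ i ⟩) ⟧ m w

    G-bounded : ∀ i → suc d ≤ i → G i ≡ 0ℚ
    G-bounded i d<i = trans (⟦⟧-cong (T-zero n (λ u → f-bd (i ∷ u) zero d<i)) m w) (constant-0 m w)

    first : ∑ (λ i → (δ₁ j ⟦ e i ⟧ ш ⟦ T n (f ⟨ toℕ i ⟩) ⟧) m w) ≡ G j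
    first = begin
      ∑ (λ i → (δ₁ j ⟦ e i ⟧ ш ⟦ T n (f ⟨ toℕ i ⟩) ⟧) m w)
        ≡⟨ ∑-cong {suc d} (λ i → trans
             (ш-congʳ ⟦ T n (f ⟨ toℕ i ⟩) ⟧ (δ₁-letters (extend (v d (toℕ i))) j) m w)
             (trans (constant-ш (extend (v d (toℕ i)) j) ⟦ T n (f ⟨ toℕ i ⟩) ⟧ m w)
               (ℚₚ.*-comm (extend (v d (toℕ i)) j) (G (toℕ i))))) ⟩
      ∑ {suc d} (λ i → G (toℕ i) * extend (v d (toℕ i)) j)
        -- S and G agree on letters up to d by `v-spanning` and vanish beyond, so both extend the
        -- same vector; this also covers a letter j larger than d.
        ≡⟨ extend-unique {a = λ i → G (toℕ i)} {g = S} spanned vanishes j ⟨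
      extend {suc d} (λ i → G (toℕ i)) j
        ≡⟨ extend-unique {a = λ i → G (toℕ i)} {g = G} (λ _ → refl) G-bounded j ⟩
      G j ∎
      where
      S : ℕ → ℚ
      S k = ∑ {suc d} (λ i → G (toℕ i) * extend (v d (toℕ i)) k)
      spanned : ∀ k → G (toℕ k) ≡ S (toℕ k)
      spanned k = trans (v-spanning d (λ i → G (toℕ i)) k)
        (trans (linearCombination-ℚ^ {suc d} (λ i → G (toℕ i)) (λ i → v d (toℕ i)) k)
          (∑-cong {suc d} (λ i → cong (G (toℕ i) *_) (sym (extend-toℕ (v d (toℕ i)) k)))))
      vanishes : ∀ k → suc d ≤ k → S k ≡ 0ℚ
      vanishes k d<k = trans
        (∑-cong {suc d} (λ i →
          trans (cong (G (toℕ i) *_) (extend-bounded (v d (toℕ i)) k d<k)) (ℚₚ.*-zeroʳ (G (toℕ i)))))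
        (∑-zero (suc d))

    rest : ∀ n {f : Vec ℕ (suc n) → ℚ} → SwapInvariant f → Bounded d f →
           ∑ (λ i → (⟦ e i ⟧ ш δ₁ j ⟦ T n (f ⟨ toℕ i ⟩) ⟧) m w) ≡ fromℕ n * ⟦ T n (f ⟨ j ⟩) ⟧ m w
    rest zero {f} f-inv f-bd = trans
      (∑-cong (λ i → ш-zeroʳ ⟦ e i ⟧ (λ _ _ → refl) m w))
      (trans (∑-zero (suc d)) (sym (ℚₚ.*-zeroˡ (⟦ T 0 (f ⟨ j ⟩) ⟧ m w))))
    rest (suc n) {f} f-inv f-bd = begin
      ∑ (λ i → (⟦ e i ⟧ ш δ₁ j ⟦ T (suc n) (f ⟨ toℕ i ⟩) ⟧) m w)
        ≡⟨ ∑-cong (λ i → trans (ш-congˡ ⟦ e i ⟧ (exchange i) m w)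
             (ш-scaleʳ (fromℕ (suc n)) ⟦ e i ⟧ ⟦ T n (f ⟨ j ⟩ ⟨ toℕ i ⟩) ⟧ m w)) ⟩
      ∑ (λ i → fromℕ (suc n) * (⟦ e i ⟧ ш ⟦ T n (f ⟨ j ⟩ ⟨ toℕ i ⟩) ⟧) m w)
        ≡⟨ *-distribˡ-∑ (fromℕ (suc n)) (λ i → (⟦ e i ⟧ ш ⟦ T n (f ⟨ j ⟩ ⟨ toℕ i ⟩) ⟧) m w) ⟨
      fromℕ (suc n) * ∑ (λ i → (⟦ e i ⟧ ш ⟦ T n (f ⟨ j ⟩ ⟨ toℕ i ⟩) ⟧) m w)
        ≡⟨ cong (fromℕ (suc n) *_) (⟦⟧-sum {suc d} (λ i → e i ⊗ T n (f ⟨ j ⟩ ⟨ toℕ i ⟩)) m w) ⟨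
      fromℕ (suc n) * ⟦ T (suc n) (f ⟨ j ⟩) ⟧ m w ∎
      where
      exchange : ∀ i → δ₁ j ⟦ T (suc n) (f ⟨ toℕ i ⟩) ⟧
                     ≐ (λ m w → fromℕ (suc n) * ⟦ T n (f ⟨ j ⟩ ⟨ toℕ i ⟩) ⟧ m w)
      exchange i m w = trans
        (δ₁-⟦T⟧ n (⟨⟩-swapInvariant f-inv (toℕ i)) (⟨⟩-bounded f-bd (toℕ i)) j m w)
        (cong (fromℕ (suc n) *_) (⟦⟧-cong (T-cong n (λ u → f-inv (swap (toℕ i) j u))) m w))

  ⟦T⟧ : ∀ n {f : Vec ℕ n → ℚ} → SwapInvariant f → Bounded d f → ∀ w → ⟦ T n f ⟧ n w ≡ factorial n * f w
  ⟦T⟧ zero {f} f-inv f-bd [] = sym (ℚₚ.*-identityˡ (f []))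
  ⟦T⟧ (suc n) {f} f-inv f-bd (j ∷ w) = trans (δ₁-⟦T⟧ n f-inv f-bd j n w)
    (trans (cong (fromℕ (suc n) *_) (⟦T⟧ n (⟨⟩-swapInvariant f-inv j) (⟨⟩-bounded f-bd j) w))
      (sym (ℚₚ.*-assoc (fromℕ (suc n)) (factorial n) (f (j ∷ w)))))

  1/factorial-⊗-cancel : ∀ n x → con (1/factorial n) ⊗ (con (factorial n) ⊗ x) ∼ x
  1/factorial-⊗-cancel n x = ∼-trans (∼-sym (⊗-assoc _ _ x))
    (∼-trans (⊗-congʳ (∼-trans (∼-sym (con-* _ _)) (≡⇒∼ (cong con (1/factorial-inverse n))))) (⊗-identityˡ x))

  -- Reduces an identity modulo `∼` in degree n to an identity of coefficients, since `T` recovers a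
  -- term from its symmetrization after division by n!.
  ⟦⟧-injective : ∀ {n x y} → HasDegree n x → HasDegree n y → (∀ w → ⟦ x ⟧ n w ≡ ⟦ y ⟧ n w) → x ∼ y
  ⟦⟧-injective {n} {x} {y} x-deg y-deg eq = begin
    x                                                      ≈⟨ 1/factorial-⊗-cancel n x ⟨
    con (1/factorial n) ⊗ (con (factorial n) ⊗ x)          ≈⟨ ⊗-congˡ (T-⟦⟧ x-deg) ⟨
    con (1/factorial n) ⊗ T n (⟦ x ⟧ n)                    ≈⟨ ⊗-congˡ (T-cong n eq) ⟩
    con (1/factorial n) ⊗ T n (⟦ y ⟧ n)                    ≈⟨ ⊗-congˡ (T-⟦⟧ y-deg) ⟩
    con (1/factorial n) ⊗ (con (factorial n) ⊗ y)          ≈⟨ 1/factorial-⊗-cancel n y ⟩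
    y                                                      ∎
    where open ∼-Reasoning

  T-1/factorial : ∀ {n x} → HasDegree n x → T n (λ w → 1/factorial n * ⟦ x ⟧ n w) ∼ x
  T-1/factorial {n} {x} x-deg = ∼-trans (T-* n (1/factorial n) (⟦ x ⟧ n))
    (∼-trans (⊗-congˡ (T-⟦⟧ x-deg)) (1/factorial-⊗-cancel n x))

  T-injective : ∀ n {f g : Vec ℕ n → ℚ} → SwapInvariant f → Bounded d f → SwapInvariant g → Bounded d g →
                T n f ∼ T n g → ∀ w → f w ≡ g w
  T-injective n {f} {g} f-inv f-bd g-inv g-bd eq w = begin
    f w                                 ≡⟨ 1/factorial-cancel n (f w) ⟨
    1/factorial n * (factorial n * f w) ≡⟨ cong (1/factorial n *_) (⟦T⟧ n f-inv f-bd w) ⟨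
    1/factorial n * ⟦ T n f ⟧ n w       ≡⟨ cong (1/factorial n *_) (⟦⟧-cong eq n w) ⟩
    1/factorial n * ⟦ T n g ⟧ n w       ≡⟨ cong (1/factorial n *_) (⟦T⟧ n g-inv g-bd w) ⟩
    1/factorial n * (factorial n * g w) ≡⟨ 1/factorial-cancel n (g w) ⟩
    g w                                 ∎
    where open ≡-Reasoning

  -- After applying ⟦_⟧ both sides are n! times `act d x f`; on the left this uses that `act d x f`
  -- is again symmetric and bounded.
  T-equivariant : ∀ n x {f : Vec ℕ n → ℚ} → SwapInvariant f → Bounded d f →
                  T n (act d x f) ∼ derivation (V-ρ d x) (T n f)
  T-equivariant n x {f} f-inv f-bd = ⟦⟧-injective
    (T-HasDegree n _) (derivation-HasDegree (IsSl₂Action.linear (V-isSl₂Action d) x) (T-HasDegree n f))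
    (λ w → begin
      ⟦ T n (act d x f) ⟧ n w
        ≡⟨ ⟦T⟧ n (act-swapInvariant d x f-inv) (act-bounded d x f-bd) w ⟩
      factorial n * act d x f w
        ≡⟨ act-* d x (factorial n) f w ⟨
      act d x (λ u → factorial n * f u) w
        ≡⟨ act-cong d x (⟦T⟧ n f-inv f-bd) w ⟨
      act d x (⟦ T n f ⟧ n) w
        ≡⟨ ⟦⟧-derivation x (T n f) n w ⟨
      ⟦ derivation (V-ρ d x) (T n f) ⟧ n w ∎)
    where open ≡-Reasoning

-- Orbits of words

_≟ʷ_ : ∀ {n} → DecidableEquality (Vec ℕ n)
_≟ʷ_ = Vecₚ.≡-dec ℕₚ._≟_

-- Puts the bound on all letters into a single swap-invariant number, which sorting preserves.
maximum : ∀ {n} → Vec ℕ n → ℕ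
maximum []      = 0
maximum (i ∷ w) = i ⊔ maximum w

maximum-swapInvariant : ∀ {n} → SwapInvariant (maximum {n})
maximum-swapInvariant (swap i j w) = trans (sym (ℕₚ.⊔-assoc i j (maximum w)))
  (trans (cong (_⊔ maximum w) (ℕₚ.⊔-comm i j)) (ℕₚ.⊔-assoc j i (maximum w)))
maximum-swapInvariant (prep i r) = cong (i ⊔_) (maximum-swapInvariant r)

lookup≤maximum : ∀ {n} (w : Vec ℕ n) k → lookup w k ≤ maximum w
lookup≤maximum (i ∷ w) zero    = ℕₚ.m≤m⊔n i (maximum w)
lookup≤maximum (i ∷ w) (suc k) = ℕₚ.≤-trans (lookup≤maximum w k) (ℕₚ.m≤n⊔m i (maximum w))

words : ℕ → ∀ n → List (Vec ℕ n)
words d zero    = [] List.∷ List.[]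
words d (suc n) = cartesianProductWith _∷_ (upTo (suc d)) (words d n)

∈-words⁺ : ∀ {d n} (w : Vec ℕ n) → (∀ k → lookup w k ≤ d) → w ∈ words d n
∈-words⁺ []      w≤d = Any.here refl
∈-words⁺ (i ∷ w) w≤d =
  ∈ₚ.∈-cartesianProductWith⁺ _∷_ (∈ₚ.∈-upTo⁺ (s≤s (w≤d zero))) (∈-words⁺ w (w≤d ∘ suc))

∈-words⁻ : ∀ {d n} {w : Vec ℕ n} → w ∈ words d n → maximum w ≤ d
∈-words⁻ {n = zero} (Any.here refl) = z≤n
∈-words⁻ {d} {suc n} w∈
  with i , u , i∈ , u∈ , refl ← ∈ₚ.∈-cartesianProductWith⁻ _∷_ (upTo (suc d)) (words d n) w∈
  = ℕₚ.⊔-lub (ℕₚ.≤-pred (∈ₚ.∈-upTo⁻ i∈)) (∈-words⁻ u∈)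

bounded-∉ : ∀ {d n} {f : Vec ℕ n → ℚ} → Bounded d f → ∀ w → w ∉ words d n → f w ≡ 0ℚ
bounded-∉ {f = f} f-bd w w∉ with f w ℚₚ.≟ 0ℚ
... | yes e = e
... | no  e = contradiction (∈-words⁺ w (λ k → ℕₚ.≮⇒≥ (λ d<w → e (f-bd w k d<w)))) w∉

boundedPolynomial : ∀ d {n} (f : Vec ℕ n → ℚ) → Bounded d f → Polynomial n
boundedPolynomial d {n} f f-bd = record
  { coeff = f ; support = words d n ; finite-support = bounded-∉ f-bd }

insert : ∀ {n} → ℕ → Vec ℕ n → Vec ℕ (suc n)
insert i [] = i ∷ []
insert i (j ∷ w) with i ℕₚ.≤? j
... | yes _ = i ∷ j ∷ w
... | no  _ = j ∷ insert i w

-- Picks the representative of an orbit. It is canonical because insertions commute (`insert-comm`),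
-- so words that differ by swaps have the same sorted form.
sort : ∀ {n} → Vec ℕ n → Vec ℕ n
sort []      = []
sort (i ∷ w) = insert i (sort w)

insert-≤ : ∀ {n i j} (w : Vec ℕ n) → i ≤ j → insert i (j ∷ w) ≡ i ∷ j ∷ w
insert-≤ {i = i} {j} w i≤j with i ℕₚ.≤? j
... | yes _   = refl
... | no  i≰j = contradiction i≤j i≰j

insert-> : ∀ {n i j} (w : Vec ℕ n) → j < i → insert i (j ∷ w) ≡ j ∷ insert i w
insert-> {i = i} {j} w j<i with i ℕₚ.≤? j
... | yes i≤j = contradiction i≤j (ℕₚ.<⇒≱ j<i)
... | no  _   = refl

private
  insert-comm-< : ∀ {n i j} → i < j → (w : Vec ℕ n) → insert i (insert j w) ≡ insert j (insert i w)
  insert-comm-< i<j [] = trans (insert-≤ [] (ℕₚ.<⇒≤ i<j)) (sym (insert-> [] i<j))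
  insert-comm-< {i = i} {j} i<j (k ∷ w) with ℕₚ.≤-<-connex j k | ℕₚ.≤-<-connex i k
  ... | inj₁ j≤k | inj₂ k<i = contradiction (ℕₚ.≤-trans (ℕₚ.<⇒≤ i<j) j≤k) (ℕₚ.<⇒≱ k<i)
  ... | inj₁ j≤k | inj₁ i≤k = begin
    insert i (insert j (k ∷ w))  ≡⟨ cong (insert i) (insert-≤ w j≤k) ⟩
    insert i (j ∷ k ∷ w)         ≡⟨ insert-≤ (k ∷ w) (ℕₚ.<⇒≤ i<j) ⟩
    i ∷ j ∷ k ∷ w                ≡⟨ cong (i ∷_) (insert-≤ w j≤k) ⟨
    i ∷ insert j (k ∷ w)         ≡⟨ insert-> (k ∷ w) i<j ⟨
    insert j (i ∷ k ∷ w)         ≡⟨ cong (insert j) (insert-≤ w i≤k) ⟨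
    insert j (insert i (k ∷ w))  ∎
    where open ≡-Reasoning
  ... | inj₂ k<j | inj₁ i≤k = begin
    insert i (insert j (k ∷ w))  ≡⟨ cong (insert i) (insert-> w k<j) ⟩
    insert i (k ∷ insert j w)    ≡⟨ insert-≤ (insert j w) i≤k ⟩
    i ∷ k ∷ insert j w           ≡⟨ cong (i ∷_) (insert-> w k<j) ⟨
    i ∷ insert j (k ∷ w)         ≡⟨ insert-> (k ∷ w) i<j ⟨
    insert j (i ∷ k ∷ w)         ≡⟨ cong (insert j) (insert-≤ w i≤k) ⟨
    insert j (insert i (k ∷ w))  ∎
    where open ≡-Reasoning
  ... | inj₂ k<j | inj₂ k<i = begin
    insert i (insert j (k ∷ w))  ≡⟨ cong (insert i) (insert-> w k<j) ⟩
    insert i (k ∷ insert j w)    ≡⟨ insert-> (insert j w) k<i ⟩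
    k ∷ insert i (insert j w)    ≡⟨ cong (k ∷_) (insert-comm-< i<j w) ⟩
    k ∷ insert j (insert i w)    ≡⟨ insert-> (insert i w) k<j ⟨
    insert j (k ∷ insert i w)    ≡⟨ cong (insert j) (insert-> w k<i) ⟨
    insert j (insert i (k ∷ w))  ∎
    where open ≡-Reasoning

insert-comm : ∀ {n} i j (w : Vec ℕ n) → insert i (insert j w) ≡ insert j (insert i w)
insert-comm i j w with ℕₚ.<-cmp i j
... | tri< i<j _ _  = insert-comm-< i<j w
... | tri≈ _ refl _ = refl
... | tri> _ _ j<i  = sym (insert-comm-< j<i w)

sort-swapInvariant : ∀ {n} → SwapInvariant (sort {n})
sort-swapInvariant (swap i j w) = insert-comm i j (sort w)
sort-swapInvariant (prep i r)   = cong (insert i) (sort-swapInvariant r)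

swapInvariant-insert : ∀ {n} {A : Set} {f : Vec ℕ (suc n) → A} → SwapInvariant f →
                       ∀ i w → f (insert i w) ≡ f (i ∷ w)
swapInvariant-insert f-inv i [] = refl
swapInvariant-insert f-inv i (j ∷ w) with i ℕₚ.≤? j
... | yes _ = refl
... | no  _ = trans (swapInvariant-insert (⟨⟩-swapInvariant f-inv j) i w) (f-inv (swap j i w))

-- An insertion is a chain of adjacent swaps. The value type is left general so that the lemma also
-- applies to `maximum` and to `sort` itself, where it gives idempotence.
swapInvariant-sort : ∀ {n} {A : Set} {f : Vec ℕ n → A} → SwapInvariant f → ∀ w → f (sort w) ≡ f w
swapInvariant-sort f-inv []      = refl
swapInvariant-sort f-inv (i ∷ w) = trans (swapInvariant-insert f-inv i (sort w))
  (swapInvariant-sort (⟨⟩-swapInvariant f-inv i) w)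

indicator : ∀ {n} → Vec ℕ n → Vec ℕ n → ℚ
indicator s w = if does (w ≟ʷ s) then 1ℚ else 0ℚ

indicator-≢ : ∀ {n} {s w : Vec ℕ n} → w ≢ s → indicator s w ≡ 0ℚ
indicator-≢ {s = s} {w} w≢s with w ≟ʷ s
... | yes e = contradiction e w≢s
... | no  _ = refl

indicator-refl : ∀ {n} (s : Vec ℕ n) → indicator s s ≡ 1ℚ
indicator-refl s with s ≟ʷ s
... | yes _ = refl
... | no  e = contradiction refl e

δ-refl : ∀ i → δ i i ≡ 1ℚ
δ-refl zero    = refl
δ-refl (suc i) = δ-refl i

δ-≢ : ∀ i j → i ≢ j → δ i j ≡ 0ℚ
δ-≢ zero    zero    i≢j = contradiction refl i≢j
δ-≢ zero    (suc j) i≢j = refl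
δ-≢ (suc i) zero    i≢j = refl
δ-≢ (suc i) (suc j) i≢j = δ-≢ i j (i≢j ∘ cong suc)

lookup-injective : ∀ {A : Set} {xs : List A} → Unique xs → ∀ i j → List.lookup xs i ≡ List.lookup xs j → i ≡ j
lookup-injective (x≢ ∷ u) zero    zero    e = refl
lookup-injective (x≢ ∷ u) zero    (suc j) e = contradiction e (All.lookup x≢ (∈ₚ.∈-lookup j))
lookup-injective (x≢ ∷ u) (suc i) zero    e = contradiction (sym e) (All.lookup x≢ (∈ₚ.∈-lookup i))
lookup-injective (x≢ ∷ u) (suc i) (suc j) e = cong suc (lookup-injective u i j e)

module _ (d n : ℕ) where

  -- One sorted word for each multiset of n letters from 0 to d, that is, for each partition fitting
  -- in an n by d box: the index set of the monomial symmetric polynomials.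
  orbits : List (Vec ℕ n)
  orbits = deduplicate _≟ʷ_ (List.map sort (words d n))

  orbit : Fin (List.length orbits) → Vec ℕ n
  orbit = List.lookup orbits

  orbit-preimage : ∀ i → ∃[ w ] w ∈ words d n × orbit i ≡ sort w
  orbit-preimage i = ∈ₚ.∈-map⁻ sort
    (∈ₚ.∈-deduplicate⁻ _≟ʷ_ (List.map sort (words d n)) (∈ₚ.∈-lookup {xs = orbits} i))

  sort-orbit : ∀ i → sort (orbit i) ≡ orbit i
  sort-orbit i with w , _ , e ← orbit-preimage i =
    trans (cong sort e) (trans (swapInvariant-sort sort-swapInvariant w) (sym e))

  maximum-orbit : ∀ i → maximum (orbit i) ≤ d
  maximum-orbit i with w , w∈ , e ← orbit-preimage i =
    subst (_≤ d) (sym (trans (cong maximum e) (swapInvariant-sort maximum-swapInvariant w))) (∈-words⁻ w∈)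

  sort∈orbits : ∀ {w} → w ∈ words d n → sort w ∈ orbits
  sort∈orbits w∈ = ∈ₚ.∈-deduplicate⁺ _≟ʷ_ (∈ₚ.∈-map⁺ sort w∈)

  indicator-orbit : ∀ i j → indicator (orbit i) (orbit j) ≡ δ (toℕ i) (toℕ j)
  indicator-orbit i j with i Finₚ.≟ j
  ... | yes refl = trans (indicator-refl (orbit i)) (sym (δ-refl (toℕ i)))
  ... | no  i≢j  = trans (indicator-≢ (λ e → i≢j (sym (lookup-injective orbits-unique j i e))))
                         (sym (δ-≢ (toℕ i) (toℕ j) (i≢j ∘ Finₚ.toℕ-injective)))
    where
    orbits-unique : Unique orbits
    orbits-unique = DecUniqueₚ.deduplicate-! _≟ʷ_ (List.map sort (words d n))

  ∑-indicator : ∀ (c : Fin (List.length orbits) → ℚ) j → ∑ (λ i → c i * indicator (orbit i) (orbit j)) ≡ c j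
  ∑-indicator c j = begin
    ∑ (λ i → c i * indicator (orbit i) (orbit j))
      ≡⟨ ∑-cong (λ i → cong (c i *_) (trans (indicator-orbit i j) (sym (ℚₚ.*-identityˡ (δ (toℕ i) (toℕ j)))))) ⟩
    ∑ (λ i → c i * (1ℚ * δ (toℕ i) (toℕ j)))
      ≡⟨ ∑-δ c (λ _ → 1ℚ) (toℕ j) ⟩
    1ℚ * extend c (toℕ j)
      ≡⟨ trans (ℚₚ.*-identityˡ (extend c (toℕ j))) (extend-toℕ c j) ⟩
    c j ∎
    where open ≡-Reasoning

  -- If `sort w` is listed, only its own orbit contributes, with the value of f there. If it is not,
  -- then w is not in `words d n`, so f vanishes at w and so does every indicator.
  ∑-orbits : ∀ {f : Vec ℕ n → ℚ} → SwapInvariant f → Bounded d f → ∀ w →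
             f w ≡ ∑ (λ i → f (orbit i) * indicator (orbit i) (sort w))
  ∑-orbits {f} f-inv f-bd w with DecMembership._∈?_ _≟ʷ_ (sort w) orbits
  ... | yes w∈ = begin
    f w                                                     ≡⟨ swapInvariant-sort f-inv w ⟨
    f (sort w)                                              ≡⟨ cong f w≡ ⟩
    f (orbit j)                                             ≡⟨ ∑-indicator (f ∘ orbit) j ⟨
    ∑ (λ i → f (orbit i) * indicator (orbit i) (orbit j))
      ≡⟨ cong (λ u → ∑ (λ i → f (orbit i) * indicator (orbit i) u)) w≡ ⟨
    ∑ (λ i → f (orbit i) * indicator (orbit i) (sort w))    ∎
    where
    open ≡-Reasoning
    j = Any.index w∈
    w≡ : sort w ≡ orbit j
    w≡ = Anyₚ.lookup-index w∈
  ... | no w∉ = trans (bounded-∉ f-bd w (w∉ ∘ sort∈orbits)) (sym (trans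
    (∑-cong (λ i → trans
      (cong (f (orbit i) *_) (indicator-≢ (λ e → w∉ (subst (_∈ orbits) (sym e) (∈ₚ.∈-lookup {xs = orbits} i)))))
      (ℚₚ.*-zeroʳ (f (orbit i)))))
    (∑-zero (List.length orbits))))

  symmetrized-swapInvariant : ∀ i → SwapInvariant (λ w → indicator (orbit i) (sort w))
  symmetrized-swapInvariant i r = cong (indicator (orbit i)) (sort-swapInvariant r)

  symmetrized-bounded : ∀ i → Bounded d (λ w → indicator (orbit i) (sort w))
  symmetrized-bounded i w k d<w = indicator-≢ {s = orbit i} {sort w} (λ e →
    ℕₚ.<⇒≱ d<w (ℕₚ.≤-trans (lookup≤maximum w k)
      (subst (_≤ d) (trans (cong maximum (sym e)) (swapInvariant-sort maximum-swapInvariant w)) (maximum-orbit i))))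

-- The submodules, the monomial basis and the isomorphism

symmetricPolynomials : ∀ n d → IsSl₂Submodule (polynomials (diffOp-isSl₂Action d n)) Symmetric
symmetricPolynomials n d = record
  { isSubspace = record
    { resp = λ e p-sym σ m → trans (sym (e _)) (trans (p-sym σ m) (e m))
    ; 0ᴹ-closed = λ σ m → refl
    ; +ᴹ-closed = λ p-sym q-sym σ m → cong₂ _+_ (p-sym σ m) (q-sym σ m)
    ; *ₗ-closed = λ c p-sym σ m → cong (c *_) (p-sym σ m)
    }
  ; ρ-closed = λ x {p} p-sym → swapInvariant⇒symmetric (diffOp n d x p) (λ {w} {w′} r →
      trans (coeff-diffOp d x p w)
        (trans (act-swapInvariant d x (symmetric⇒swapInvariant p p-sym) r) (sym (coeff-diffOp d x p w′))))
  }

degree≤-submodule : ∀ n d →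
  IsSl₂Submodule (submodule (polynomials (diffOp-isSl₂Action d n)) (symmetricPolynomials n d))
                 (λ p → DegreeInEachVariable≤ d (proj₁ p))
degree≤-submodule n d = record
  { isSubspace = record
    { resp = λ e p≤ m m≢0 → p≤ m (m≢0 ∘ trans (sym (e m)))
    ; 0ᴹ-closed = λ m m≢0 → contradiction refl m≢0
    ; +ᴹ-closed = λ {p} {q} p≤ q≤ → bounded⇒degree≤ (proj₁ p +ᴹ proj₁ q) (λ m k d<m →
        cong₂ _+_ (degree≤⇒bounded (proj₁ p) p≤ m k d<m) (degree≤⇒bounded (proj₁ q) q≤ m k d<m))
    ; *ₗ-closed = λ c {p} p≤ → bounded⇒degree≤ (c *ₗ proj₁ p) (λ m k d<m →
        trans (cong (c *_) (degree≤⇒bounded (proj₁ p) p≤ m k d<m)) (ℚₚ.*-zeroʳ c))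
    }
  ; ρ-closed = λ x {p} p≤ → bounded⇒degree≤ (diffOp n d x (proj₁ p)) (λ m k d<m →
      trans (coeff-diffOp d x (proj₁ p) m)
        (act-bounded d x (degree≤⇒bounded (proj₁ p) p≤) m k d<m))
  }
  where open LeftModule (ℚ[x] n)

module _ (n d : ℕ) where

  Λ≤ : Sl₂Module
  Λ≤ = submodule
    (submodule (polynomials (diffOp-isSl₂Action d n)) (symmetricPolynomials n d))
    (degree≤-submodule n d)

  private
    module Λ≤ = Sl₂Module Λ≤
    module S = Sl₂Module (SymmetricPower n (V d))
  open Polarization d
  open SymmetricAlgebra (ℚ^ (suc d)) using (∼-trans)

  coefficient : Λ≤.Carrierᴹ → Vec ℕ n → ℚ
  coefficient ((p , _) , _) = coeff p

  coefficient-swapInvariant : ∀ p → SwapInvariant (coefficient p)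
  coefficient-swapInvariant ((p , p-sym) , _) = symmetric⇒swapInvariant p p-sym

  coefficient-bounded : ∀ p → Bounded d (coefficient p)
  coefficient-bounded ((p , _) , p≤) = degree≤⇒bounded p p≤

  fromCoefficient : (f : Vec ℕ n → ℚ) → SwapInvariant f → Bounded d f → Λ≤.Carrierᴹ
  fromCoefficient f f-inv f-bd = (p , swapInvariant⇒symmetric p f-inv) , bounded⇒degree≤ p f-bd
    where p = boundedPolynomial d f f-bd

  coefficient-linearCombination : ∀ {k} c (b : Fin k → Λ≤.Carrierᴹ) w →
    coefficient (linearCombination Λ≤.space c b) w ≡ ∑ (λ i → c i * coefficient (b i) w)
  coefficient-linearCombination {zero}  c b w = refl
  coefficient-linearCombination {suc k} c b w =
    cong (c zero * coefficient (b zero) w +_) (coefficient-linearCombination (c ∘ suc) (b ∘ suc) w)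

  monomialSymmetrics : Fin (List.length (orbits d n)) → Λ≤.Carrierᴹ
  monomialSymmetrics i = fromCoefficient (λ w → indicator (orbit d n i) (sort w))
    (symmetrized-swapInvariant d n i) (symmetrized-bounded d n i)

  -- The coefficients at the orbit representatives are the dual basis: evaluating there gives
  -- independence, and the values of p there are its coordinates.
  monomialSymmetrics-isBasis : IsBasis Λ≤.space monomialSymmetrics
  monomialSymmetrics-isBasis = record
    { independent = λ c e j → begin
        c j
          ≡⟨ ∑-indicator d n c j ⟨
        ∑ (λ i → c i * indicator (orbit d n i) (orbit d n j))
          ≡⟨ cong (λ u → ∑ (λ i → c i * indicator (orbit d n i) u)) (sort-orbit d n j) ⟨
        ∑ (λ i → c i * indicator (orbit d n i) (sort (orbit d n j)))
          ≡⟨ coefficient-linearCombination c monomialSymmetrics (orbit d n j) ⟨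
        coefficient (linearCombination Λ≤.space c monomialSymmetrics) (orbit d n j)
          ≡⟨ e (orbit d n j) ⟩
        0ℚ ∎
    ; spanning = λ p → coefficient p ∘ orbit d n , λ w → trans
        (∑-orbits d n (coefficient-swapInvariant p) (coefficient-bounded p) w)
        (sym (coefficient-linearCombination (coefficient p ∘ orbit d n) monomialSymmetrics w))
    }
    where open ≡-Reasoning

  polarize : Λ≤.Carrierᴹ → S.Carrierᴹ
  polarize p = T n (coefficient p) , T-HasDegree n (coefficient p)

  polarize-isomorphism : IsLinearIsomorphism Λ≤.space S.space polarize
  polarize-isomorphism = record
    { isLeftModuleMonomorphism = record
      { isLeftModuleHomomorphism = mkLinear Λ≤.space S.space polarize
          (λ {p} {q} e → T-cong n e)
          (λ p q → T-+ n (coefficient p) (coefficient q))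
          (λ c p → T-* n c (coefficient p))
      ; injective = λ {p} {q} → T-injective n
          (coefficient-swapInvariant p) (coefficient-bounded p)
          (coefficient-swapInvariant q) (coefficient-bounded q)
      }
    -- The preimage of y is its symmetrization divided by n!; it is symmetric and bounded for every
    -- term y, while `T` returns y because y has degree n.
    ; surjective = λ { (y , y-deg) →
          fromCoefficient (λ w → 1/factorial n * ⟦ y ⟧ n w)
            (λ r → cong (1/factorial n *_) (⟦⟧-swapInvariant y n r))
            (λ w k d<w → trans (cong (1/factorial n *_) (⟦⟧-bounded y n w k d<w)) (ℚₚ.*-zeroʳ (1/factorial n)))
        , λ e → ∼-trans (T-cong n e) (T-1/factorial y-deg) }
    }

  polarize-equivariant : ∀ x p → polarize (Λ≤.ρ x p) S.≈ᴹ S.ρ x (polarize p)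
  polarize-equivariant x p = ∼-trans
    (T-cong n (coeff-diffOp d x (proj₁ (proj₁ p))))
    (T-equivariant n x (coefficient-swapInvariant p) (coefficient-bounded p))

mainTheorem9 : (n d : ℕ) → 1 ≤ n → 1 ≤ d →
    Σ[ action ∈ IsSl₂Action (ℚ[x] n) (diffOp n d) ]
    Σ[ Λ ∈ IsSl₂Submodule (polynomials action) Symmetric ]
    Σ[ Λ≤d ∈ IsSl₂Submodule (submodule (polynomials action) Λ) (λ p → DegreeInEachVariable≤ d (proj₁ p)) ]
    (FiniteDimensional (Sl₂Module.space (submodule (submodule (polynomials action) Λ) Λ≤d))
    × (submodule (submodule (polynomials action) Λ) Λ≤d ≅ SymmetricPower n (V d)))
mainTheorem9 n d _ _ =
    diffOp-isSl₂Action d n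
  , symmetricPolynomials n d
  , degree≤-submodule n d
  , (List.length (orbits d n) , monomialSymmetrics n d , monomialSymmetrics-isBasis n d)
  , record
    { to = polarize n d
    ; isomorphism = polarize-isomorphism n d
    ; equivariant = polarize-equivariant n d
    }
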